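{- Let $f_1,\dots,f_m$ be rational linear forms on $\mathbb{R}^d$ of weight zero, i.e. $f_i(1,1,\dots,1)=0$ for all $i$; let $s := \{x : f_1(x)=\cdots=f_m(x)=0\}$, $P:=[0,1]^d\cap s$, and $\mathcal{H} := \{h_{jk}\cap s : 1\le j<k\le d,\ h_{jk}\not\supseteq s\}$ where $h_{jk}$ is the hyperplane $x_j=x_k$. Assume a magic labelling exists, i.e. $s$ contains an integer point with distinct positive coordinates. Let $B^\circ(t)$ be the number of integer points $x\in s$ with distinct entries and $0<x_i<t$, and $B(t)$ the number of pairs $(x,\sigma)$ with $x\in s\cap\mathbb{Z}^d$, $0\le x_i\le t$, and $\sigma$ a permutation of $[d]$ compatible with $x$ and realizable in $s$. Then $$B^\circ(t) = \sum_{u\in\mathcal{L}(P^\circ,\mathcal{H})}\mu(\hat 0,u)\,E_{(0,1)^d\cap u}(t),\qquad B(t)=\sum_{u\in\mathcal{L}(P^\circ,\mathcal{H})}|\mu(\hat 0,u)|\,E_{[0,1]^d\cap u}(t),$$ where $\mu$ is the Möbius function of $\mathcal{L}(P^\circ,\mathcal{H})$.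
   Context: $\mathcal{L}(P^\circ,\mathcal{H}) := \{P^\circ\cap\bigcap\mathcal{S} : \mathcal{S}\subseteq\mathcal{H}\}\setminus\{\emptyset\}$, ordered by reverse inclusion, with bottom element $\hat 0 = P^\circ$ (the relative interior of $P$). For a member $u$, $E_{Q\cap u}(t)$ denotes the number of integer points in $t(Q\cap \bar u)$, where $\bar u = \bigcap\mathcal S$ is the flat (affine span of $u$) whose intersection with $P^\circ$ is $u$. The Möbius function is $\mu(r,r)=1$, $\mu(r,s)=-\sum_{r\le w<s}\mu(r,w)$ for $r<s$, and $0$ otherwise. A point $x$ with distinct coordinates realizes the permutation $\tau$ if $x_{\tau1}<\cdots<x_{\tau d}$; realizable in $s$ means realized by some point of $s$; $x$ and $\sigma$ are compatible if $x_{\sigma1}\le\cdots\le x_{\sigma d}$. -}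

module Defs where

open import Level using (0ℓ)
open import Data.Nat as ℕ using (ℕ; zero; suc; NonZero)
open import Data.Integer as ℤ using (ℤ)
open import Data.Rational as ℚ using (ℚ; 0ℚ; 1ℚ)
open import Data.Fin as Fin using (Fin)
open import Data.Vec as Vec using (Vec; lookup)
open import Data.List as List using (List; length)
open import Data.List.Membership.Propositional using (_∈_)
open import Data.List.Relation.Unary.All using (All)
open import Data.List.Relation.Unary.Unique.Propositional using (Unique)
open import Data.Product using (Σ; ∃; _×_; _,_)
open import Relation.Nullary using (¬_)
open import Relation.Binary.PropositionalEquality using (_≡_; _≢_)
open import Function.Bundles using (_⇔_)

-- points of ℚ^d (rational points of ℝ^d), as functions
Pt : ℕ → Set
Pt d = Fin d → ℚ

sumFin : ∀ {n} → (Fin n → ℚ) → ℚ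
sumFin {zero}  f = 0ℚ
sumFin {suc n} f = f Fin.zero ℚ.+ sumFin (λ i → f (Fin.suc i))

LinForm : ℕ → Set
LinForm d = Fin d → ℚ

eval : ∀ {d} → LinForm d → Pt d → ℚ
eval c x = sumFin (λ i → c i ℚ.* x i)

WeightZero : ∀ {d} → LinForm d → Set
WeightZero f = eval f (λ _ → 1ℚ) ≡ 0ℚ

InS : ∀ {d m} → (Fin m → LinForm d) → Pt d → Set
InS fs x = ∀ i → eval (fs i) x ≡ 0ℚ

ClosedCube : ∀ {d} → Pt d → Set
ClosedCube x = ∀ i → (0ℚ ℚ.≤ x i) × (x i ℚ.≤ 1ℚ)

OpenCube : ∀ {d} → Pt d → Set
OpenCube x = ∀ i → (0ℚ ℚ.< x i) × (x i ℚ.< 1ℚ)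

InP : ∀ {d m} → (Fin m → LinForm d) → Pt d → Set
InP fs x = ClosedCube x × InS fs x

-- relative interior of a convex set C:
-- x ∈ ri C  iff  x ∈ C and for every y ∈ C the segment from y through x
-- extends a little beyond x inside C  (Rockafellar, Thm 6.4)
RelInt : ∀ {d} → (Pt d → Set) → Pt d → Set
RelInt {d} C x = C x × (∀ y → C y →
  ∃ λ (ε : ℚ) → (0ℚ ℚ.< ε) × C (λ i → x i ℚ.+ ε ℚ.* (x i ℚ.- y i)))

InP° : ∀ {d m} → (Fin m → LinForm d) → Pt d → Set
InP° fs = RelInt (InP fs)

Pair : ℕ → Set
Pair d = Fin d × Fin d

OnH : ∀ {d} → Pair d → Pt d → Set
OnH (j , k) x = x j ≡ x k

InHIndex : ∀ {d m} → (Fin m → LinForm d) → Pair d → Set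
InHIndex fs (j , k) = (j Fin.< k) × ¬ (∀ x → InS fs x → OnH (j , k) x)

-- a subset 𝓢 ⊆ 𝓗, given by a list of index pairs
ValidSub : ∀ {d m} → (Fin m → LinForm d) → List (Pair d) → Set
ValidSub fs S = All (InHIndex fs) S

InU : ∀ {d m} → (Fin m → LinForm d) → List (Pair d) → Pt d → Set
InU fs S x = InP° fs x × All (λ p → OnH p x) S

-- the flat ū = ⋂𝓢 (inside s; for 𝓢 = ∅ this is s = aff P°)
InFlat : ∀ {d m} → (Fin m → LinForm d) → List (Pair d) → Pt d → Set
InFlat fs S x = InS fs x × All (λ p → OnH p x) S

NonemptyU : ∀ {d m} → (Fin m → LinForm d) → List (Pair d) → Set
NonemptyU fs S = ∃ λ x → InU fs S x

SameU : ∀ {d m} → (Fin m → LinForm d) → List (Pair d) → List (Pair d) → Set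
SameU fs S S' = ∀ x → (InU fs S x → InU fs S' x) × (InU fs S' x → InU fs S x)

SubU : ∀ {d m} → (Fin m → LinForm d) → List (Pair d) → List (Pair d) → Set
SubU fs S S' = ∀ x → InU fs S x → InU fs S' x

-- w < u in 𝓛(P°,𝓗) (reverse inclusion): u ⊊ w
Below : ∀ {d m} → (Fin m → LinForm d) → List (Pair d) → List (Pair d) → Set
Below fs w u = SubU fs u w × ¬ SubU fs w u

data AllPairsDistinct {A : Set} (R : A → A → Set) : List A → Set where
  []  : AllPairsDistinct R List.[]
  _∷_ : ∀ {a as} → All (λ b → ¬ R a b) as → AllPairsDistinct R as →
        AllPairsDistinct R (a List.∷ as)

EnumL : ∀ {d m} → (Fin m → LinForm d) → List (List (Pair d)) → Set
EnumL {d} fs reps =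
  All (λ S → ValidSub fs S × NonemptyU fs S) reps
  × AllPairsDistinct (SameU fs) reps
  × (∀ (S : List (Pair d)) → ValidSub fs S → NonemptyU fs S →
       ∃ λ S' → (S' ∈ reps) × SameU fs S S')

HasCard : {A : Set} → (A → Set) → ℕ → Set
HasCard {A} P n = ∃ λ (xs : List A) →
  Unique xs × (length xs ≡ n) × (∀ a → (a ∈ xs) ⇔ P a)

IPt : ℕ → Set
IPt d = Vec ℤ d

toPt : ∀ {d} → IPt d → Pt d
toPt x i = lookup x i ℚ./ 1

scale : ∀ {d} → (t : ℕ) → .{{NonZero t}} → IPt d → Pt d
scale t x i = lookup x i ℚ./ t

-- x ∈ t(Q ∩ ū)  iff  x/t ∈ Q ∩ ū
InDilate : ∀ {d} → (Q : Pt d → Set) → (Pt d → Set) → (t : ℕ) → .{{NonZero t}} →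
           IPt d → Set
InDilate Q U t x = Q (scale t x) × U (scale t x)

DistinctEntries : ∀ {d} → IPt d → Set
DistinctEntries x = ∀ i j → i ≢ j → lookup x i ≢ lookup x j

Perm : ℕ → Set
Perm d = Vec (Fin d) d

IsPerm : ∀ {d} → Perm d → Set
IsPerm σ = ∀ i j → lookup σ i ≡ lookup σ j → i ≡ j

Realizes : ∀ {d} → Pt d → Perm d → Set
Realizes x τ = ∀ i j → i Fin.< j → x (lookup τ i) ℚ.< x (lookup τ j)

RealizableIn : ∀ {d m} → (Fin m → LinForm d) → Perm d → Set
RealizableIn fs τ = ∃ λ x → InS fs x × Realizes x τ

Compatible : ∀ {d} → IPt d → Perm d → Set
Compatible x σ = ∀ i j → i Fin.< j → lookup x (lookup σ i) ℤ.≤ lookup x (lookup σ j)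

MagicExists : ∀ {d m} → (Fin m → LinForm d) → Set
MagicExists {d} fs = ∃ λ (x : IPt d) →
  InS fs (toPt x) × DistinctEntries x × (∀ i → ℤ.+ 0 ℤ.< lookup x i)

BoPt : ∀ {d m} → (Fin m → LinForm d) → ℕ → IPt d → Set
BoPt fs t x = InS fs (toPt x) × DistinctEntries x ×
  (∀ i → (ℤ.+ 0 ℤ.< lookup x i) × (lookup x i ℤ.< ℤ.+ t))

BPair : ∀ {d m} → (Fin m → LinForm d) → ℕ → IPt d × Perm d → Set
BPair fs t (x , σ) = InS fs (toPt x) ×
  (∀ i → (ℤ.+ 0 ℤ.≤ lookup x i) × (lookup x i ℤ.≤ ℤ.+ t)) ×
  IsPerm σ × Compatible x σ × RealizableIn fs σ

sumℤ : List ℤ → ℤ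
sumℤ = List.foldr ℤ._+_ (ℤ.+ 0)

{-# OPTIONS --safe #-}
module Submission where

-- For an integer point x of s in the dilated cube, the flats u through x are those spanned by
-- coincidences x_j = x_k of x.  Counting pairs (x , u) reduces both formulas to sums over the
-- interval below the flat of x:  ∑ μ(u) is 1 if x has no coincidences and 0 otherwise, which
-- gives B°, and ∑ |μ(u)| has to be the number of realizable permutations compatible with x.
-- Perturbing x inside s identifies these permutations with the regions of the localization
-- {h_jk : x_j = x_k}, so the latter is Zaslavsky's theorem.  It is proved by
-- deletion–restriction: Whitney's formula expresses μ(u) as an alternating sum over subsets of
-- the arrangement, a sum whose sign is the parity of the rank (Jordan–Hölder, from the exchange
-- property) and whose absolute value obeys the same recursion as the number of regions.

-- Weight zero puts the diagonal into s, so every flat passes through the centre (1/2, ..., 1/2) of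
-- the cube and, contracted towards it, meets P°. Hence 𝓛(P°, 𝓗) is the full intersection lattice of
-- a central arrangement, and inclusion between its members is linear entailment between lists of
-- hyperplanes. The magic labelling makes the resulting matroid loopless. The obstacle is
-- constructive: entailment quantifies over all points of s. Its decision is extracted from
-- `below?`, and ranks come from chains of flats, not from dimensions. Deletion-restriction needs a
-- point off a hyperplane, whose absence is refuted without the point being produced; so regions are
-- counted under a double negation, removed only when an equation between natural numbers is left.
-- Localization is essential to Whitney's sum: over the hyperplanes through x it obeys the Möbius
-- recursion on the flats containing x, not on all of 𝓛.

open import Defs
open import Algebra.Properties.AbelianGroup using (∙-cancelˡ; ∙-cancelʳ)
open import Data.Bool as Bool using (Bool; true; false; not; if_then_else_)
import Data.Bool.Properties as Bool
open import Data.Empty using (⊥)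
open import Data.Fin as Fin using (Fin)
import Data.Fin.Properties as Fin
open import Data.Integer as ℤ using (ℤ; +_; ∣_∣; 0ℤ; 1ℤ)
import Data.Integer.Properties as ℤ
import Data.Integer.Tactic.RingSolver as ℤ-Solver
open import Data.List as List using (List; []; _∷_; _++_; map; filter; length; allFin; cartesianProduct)
import Data.List.Membership.DecPropositional as DecMembership
open import Data.List.Membership.Propositional using (_∈_; find; lose)
open import Data.List.Membership.Propositional.Properties using (∈-++⁺ˡ; ∈-++⁺ʳ; ∈-++⁻; ∈-map⁺; ∈-map⁻; ∈-filter⁺; ∈-filter⁻; ∈-allFin; ∈-cartesianProduct⁺)
open import Data.List.Properties using (∷-injectiveˡ; ∷-injectiveʳ; length-++; length-map; length-tabulate; filter-notAll; ≡-dec)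
open import Data.List.Relation.Unary.All as All using (All; []; _∷_; all?)
open import Data.List.Relation.Unary.AllPairs using ([]; _∷_)
open import Data.List.Relation.Unary.Any using (here; there; any?)
open import Data.List.Relation.Unary.Unique.Propositional using (Unique)
open import Data.List.Relation.Unary.Unique.Propositional.Properties using (map⁺; ++⁺; filter⁺)
open import Data.Nat as ℕ using (ℕ; zero; suc; NonZero)
open import Data.Nat.ListAction using (sum)
import Data.Nat.Properties as ℕ
open import Data.Product using (∃; _×_; _,_; proj₁; proj₂; swap)
open import Data.Rational as ℚ using (ℚ; 0ℚ; 1ℚ; ½)
import Data.Rational.Properties as ℚ
import Data.Rational.Unnormalised as ℚᵘ
import Data.Rational.Unnormalised.Properties as ℚᵘ
open import Data.Sum using (_⊎_; inj₁; inj₂)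
open import Data.Vec as Vec using (lookup; tabulate)
import Data.Vec.Properties as Vec
open import Function using (_∘_; id)
open import Function.Bundles using (_⇔_; mk⇔; Equivalence)
open import Relation.Binary.Definitions using (Tri; tri<; tri≈; tri>)
open import Relation.Binary.PropositionalEquality
open import Relation.Nullary using (¬_; Dec; yes; no; does; contradiction; ¬?; _×-dec_)
open import Relation.Nullary.Decidable using (dec-true; dec-false; decidable-stable; dec⇒maybe)
open import Relation.Unary using (Decidable)
open import Tactic.RingSolver using (solve-∀)
open import Tactic.RingSolver.Core.AlmostCommutativeRing using (AlmostCommutativeRing; fromCommutativeRing)

-- Indicators, finite sums and double counting

private
  variable
    A B : Set
    P Q : Set

module _ where

  open import Data.Integer using (_+_; _*_; _-_)

  ⟦_⟧ : Dec P → ℤ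
  ⟦ p ⟧ = if does p then 1ℤ else 0ℤ

  ⟦⟧-yes : (p? : Dec P) → P → ⟦ p? ⟧ ≡ 1ℤ
  ⟦⟧-yes (yes _) p = refl
  ⟦⟧-yes (no ¬p) p = contradiction p ¬p

  ⟦⟧-no : (p? : Dec P) → ¬ P → ⟦ p? ⟧ ≡ 0ℤ
  ⟦⟧-no (yes p) ¬p = contradiction p ¬p
  ⟦⟧-no (no _)  ¬p = refl

  ⟦⟧-cong : (p? : Dec P) (q? : Dec Q) → (P → Q) → (Q → P) → ⟦ p? ⟧ ≡ ⟦ q? ⟧
  ⟦⟧-cong (yes p) q? f g = sym (⟦⟧-yes q? (f p))
  ⟦⟧-cong (no ¬p) q? f g = sym (⟦⟧-no q? (¬p ∘ g))

  ∑ : (A → ℤ) → List A → ℤ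
  ∑ f xs = sumℤ (map f xs)

  ∑-cong : {f g : A → ℤ} (xs : List A) → (∀ x → x ∈ xs → f x ≡ g x) → ∑ f xs ≡ ∑ g xs
  ∑-cong []       eq = refl
  ∑-cong (x ∷ xs) eq = cong₂ _+_ (eq x (here refl)) (∑-cong xs λ y y∈ → eq y (there y∈))

  ∑-zero : {f : A → ℤ} (xs : List A) → (∀ x → x ∈ xs → f x ≡ 0ℤ) → ∑ f xs ≡ 0ℤ
  ∑-zero []       eq = refl
  ∑-zero (x ∷ xs) eq = cong₂ _+_ (eq x (here refl)) (∑-zero xs λ y y∈ → eq y (there y∈))

  ∑-+ : (f g : A → ℤ) (xs : List A) → ∑ (λ x → f x + g x) xs ≡ ∑ f xs + ∑ g xs
  ∑-+ f g []       = refl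
  ∑-+ f g (x ∷ xs) = trans (cong (_+_ (f x + g x)) (∑-+ f g xs)) (interchange (f x) (g x) (∑ f xs) (∑ g xs))
    where
    interchange : ∀ a b c e → a + b + (c + e) ≡ a + c + (b + e)
    interchange = ℤ-Solver.solve-∀

  ∑-- : (f g : A → ℤ) (xs : List A) → ∑ (λ x → f x - g x) xs ≡ ∑ f xs - ∑ g xs
  ∑-- f g []       = refl
  ∑-- f g (x ∷ xs) = trans (cong (_+_ (f x - g x)) (∑-- f g xs)) (interchange (f x) (g x) (∑ f xs) (∑ g xs))
    where
    interchange : ∀ a b c e → a - b + (c - e) ≡ a + c - (b + e)
    interchange = ℤ-Solver.solve-∀

  ∑-distribˡ : (k : ℤ) (f : A → ℤ) (xs : List A) → ∑ (λ x → k * f x) xs ≡ k * ∑ f xs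
  ∑-distribˡ k f []       = sym (ℤ.*-zeroʳ k)
  ∑-distribˡ k f (x ∷ xs) = trans (cong (_+_ (k * f x)) (∑-distribˡ k f xs)) (sym (ℤ.*-distribˡ-+ k (f x) (∑ f xs)))

  ∑-swap : (f : A → B → ℤ) (xs : List A) (ys : List B) →
           ∑ (λ x → ∑ (f x) ys) xs ≡ ∑ (λ y → ∑ (λ x → f x y) xs) ys
  ∑-swap f []       ys = sym (∑-zero ys λ _ _ → refl)
  ∑-swap f (x ∷ xs) ys = trans (cong (_+_ (∑ (f x) ys)) (∑-swap f xs ys))
                               (sym (∑-+ (f x) (λ y → ∑ (λ x → f x y) xs) ys))

  module _ {P : A → Set} (P? : Decidable P) where

    ∑-filter : (f : A → ℤ) (xs : List A) → ∑ f (filter P? xs) ≡ ∑ (λ x → f x * ⟦ P? x ⟧) xs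
    ∑-filter f []       = refl
    ∑-filter f (x ∷ xs) with does (P? x)
    ... | true  = cong₂ _+_ (sym (ℤ.*-identityʳ (f x))) (∑-filter f xs)
    ... | false = trans (∑-filter f xs) (trans (sym (ℤ.+-identityˡ _)) (cong (_+ _) (sym (ℤ.*-zeroʳ (f x)))))

    length-filter-∑ : (xs : List A) → + length (filter P? xs) ≡ ∑ (λ x → ⟦ P? x ⟧) xs
    length-filter-∑ []       = refl
    length-filter-∑ (x ∷ xs) with does (P? x)
    ... | true  = cong (_+_ 1ℤ) (length-filter-∑ xs)
    ... | false = trans (length-filter-∑ xs) (sym (ℤ.+-identityˡ _))

  +-sum : (f : A → ℕ) (xs : List A) → + sum (map f xs) ≡ ∑ (λ x → + f x) xs
  +-sum f []       = refl
  +-sum f (x ∷ xs) = cong (_+_ (+ f x)) (+-sum f xs)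

  remove : {x : A} (xs : List A) → x ∈ xs → List A
  remove (_ ∷ xs) (here _)  = xs
  remove (x ∷ xs) (there p) = x ∷ remove xs p

  length-remove : {x : A} {xs : List A} (p : x ∈ xs) → length xs ≡ suc (length (remove xs p))
  length-remove (here _)  = refl
  length-remove (there p) = cong suc (length-remove p)

  ∈-remove : {x y : A} {xs : List A} (p : x ∈ xs) → y ∈ xs → y ≢ x → y ∈ remove xs p
  ∈-remove (here refl) (here refl) y≢x = contradiction refl y≢x
  ∈-remove (here _)    (there q)   y≢x = q
  ∈-remove (there p)   (here refl) y≢x = here refl
  ∈-remove (there p)   (there q)   y≢x = there (∈-remove p q y≢x)

  -- Stated for a relation because a permutation and its sign vector are linked by the existence of
  -- a realizing point, not by a function. Injectivity is asked only on `xs`, where compatibility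
  -- with x is known.
  length-≤-by : (R : A → B → Set) {xs : List A} {ys : List B} → Unique xs →
                (∀ x → x ∈ xs → ∃ λ y → y ∈ ys × R x y) →
                (∀ x x' y → x ∈ xs → x' ∈ xs → R x y → R x' y → x ≡ x') →
                length xs ℕ.≤ length ys
  length-≤-by R {[]}     {ys} u        tot inj = ℕ.z≤n
  length-≤-by R {x ∷ xs} {ys} (x∉ ∷ u) tot inj =
    subst (suc (length xs) ℕ.≤_) (sym (length-remove y∈))
      (ℕ.s≤s (length-≤-by R u tot' λ a a' b a∈ a'∈ → inj a a' b (there a∈) (there a'∈)))
    where
    y   = proj₁ (tot x (here refl))
    y∈  = proj₁ (proj₂ (tot x (here refl)))
    Rxy = proj₂ (proj₂ (tot x (here refl)))
    tot' : ∀ a → a ∈ xs → ∃ λ b → b ∈ remove ys y∈ × R a b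
    tot' a a∈ with b , b∈ , Rab ← tot a (there a∈) = b , ∈-remove y∈ b∈ b≢y , Rab
      where
      b≢y : b ≢ y
      b≢y refl = All.lookup x∉ a∈ (inj x a y (here refl) (there a∈) Rxy Rab)

  length-≡-by : (R : A → B → Set) {xs : List A} {ys : List B} → Unique xs → Unique ys →
                (∀ x → x ∈ xs → ∃ λ y → y ∈ ys × R x y) →
                (∀ y → y ∈ ys → ∃ λ x → x ∈ xs × R x y) →
                (∀ x x' y → x ∈ xs → x' ∈ xs → R x y → R x' y → x ≡ x') →
                (∀ x y y' → R x y → R x y' → y ≡ y') →
                length xs ≡ length ys
  length-≡-by R ux uy totˡ totʳ injˡ injʳ = ℕ.≤-antisym
    (length-≤-by R ux totˡ injˡ)
    (length-≤-by (λ y x → R x y) uy totʳ λ y y' x _ _ → injʳ x y y')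

  Unique-length : {xs ys : List A} → Unique xs → Unique ys →
                  (∀ a → a ∈ xs → a ∈ ys) → (∀ a → a ∈ ys → a ∈ xs) → length xs ≡ length ys
  Unique-length ux uy f g = length-≡-by _≡_ ux uy (λ x x∈ → x , f x x∈ , refl) (λ y y∈ → y , g y y∈ , refl)
    (λ x x' y _ _ p q → trans p (sym q)) (λ x y y' p q → trans (sym p) q)

  -- Used with `xs` the integer points of s in the dilated box: B° and the numbers `E u` become
  -- indicator sums over one common list, so that summations can be exchanged.
  HasCard-filter : {Q R P : A → Set} (P? : Decidable P) (xs : List A) → Unique xs → (∀ a → a ∈ xs ⇔ Q a) →
                   (∀ a → R a → Q a × P a) → (∀ a → Q a → P a → R a) →
                   ∀ {n} → HasCard R n → + n ≡ ∑ (λ a → ⟦ P? a ⟧) xs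
  HasCard-filter P? xs ux mem f g (ys , uy , refl , mem') = trans
    (cong +_ (Unique-length uy (filter⁺ P? ux)
      (λ a a∈ → let q , p = f a (Equivalence.to (mem' a) a∈) in ∈-filter⁺ P? (Equivalence.from (mem a) q) p)
      (λ a a∈ → let a∈xs , p = ∈-filter⁻ P? a∈ in Equivalence.from (mem' a) (g a (Equivalence.to (mem a) a∈xs) p))))
    (length-filter-∑ P? xs)

  ∑-⟦≡⟧ : (_≟_ : (a b : A) → Dec (a ≡ b)) {xs : List A} → Unique xs → ∀ {a} → a ∈ xs → ∑ (λ x → ⟦ a ≟ x ⟧) xs ≡ 1ℤ
  ∑-⟦≡⟧ _≟_ {x ∷ xs} (x∉ ∷ u) (here refl) =
    cong₂ _+_ (⟦⟧-yes (x ≟ x) refl) (∑-zero xs λ y y∈ → ⟦⟧-no (x ≟ y) (All.lookup x∉ y∈))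
  ∑-⟦≡⟧ _≟_ {x ∷ xs} (x∉ ∷ u) {a} (there a∈) =
    cong₂ _+_ (⟦⟧-no (a ≟ x) (All.lookup x∉ a∈ ∘ sym)) (∑-⟦≡⟧ _≟_ u a∈)

  length-fibres : (_≟_ : (a b : A) → Dec (a ≡ b)) (f : B → A) {xs : List A} → Unique xs →
                  (ys : List B) → All (λ y → f y ∈ xs) ys →
                  + length ys ≡ ∑ (λ x → + length (filter (λ y → f y ≟ x) ys)) xs
  length-fibres _≟_ f {xs} ux ys f∈ = begin
    + length ys                                              ≡⟨ ones ys ⟩
    ∑ (λ _ → 1ℤ) ys                                          ≡⟨ ∑-cong ys (λ y y∈ → sym (∑-⟦≡⟧ _≟_ ux (All.lookup f∈ y∈))) ⟩
    ∑ (λ y → ∑ (λ x → ⟦ f y ≟ x ⟧) xs) ys                    ≡⟨ ∑-swap (λ y x → ⟦ f y ≟ x ⟧) ys xs ⟩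
    ∑ (λ x → ∑ (λ y → ⟦ f y ≟ x ⟧) ys) xs                    ≡⟨ ∑-cong xs (λ x _ → sym (length-filter-∑ (λ y → f y ≟ x) ys)) ⟩
    ∑ (λ x → + length (filter (λ y → f y ≟ x) ys)) xs        ∎
    where
    open ≡-Reasoning
    ones : ∀ zs → + length zs ≡ ∑ (λ _ → 1ℤ) zs
    ones []       = refl
    ones (z ∷ zs) = cong (_+_ 1ℤ) (ones zs)

  ∑-incidence : {F : A → B → Set} (F? : ∀ u x → Dec (F u x)) (g : A → ℤ) (E : A → ℕ) (us : List A) (xs : List B) →
                (∀ u → u ∈ us → + E u ≡ ∑ (λ x → ⟦ F? u x ⟧) xs) →
                ∑ (λ u → g u * + E u) us ≡ ∑ (λ x → ∑ (λ u → g u * ⟦ F? u x ⟧) us) xs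
  ∑-incidence F? g E us xs count = trans
    (∑-cong us λ u u∈ → trans (cong (g u *_) (count u u∈)) (sym (∑-distribˡ (g u) (λ x → ⟦ F? u x ⟧) xs)))
    (∑-swap (λ u x → g u * ⟦ F? u x ⟧) us xs)

length-filter-≤ : {A : Set} {P Q : A → Set} (P? : Decidable P) (Q? : Decidable Q) → (∀ x → P x → Q x) →
                  ∀ xs → length (filter P? xs) ℕ.≤ length (filter Q? xs)
length-filter-≤ P? Q? P⇒Q []       = ℕ.z≤n
length-filter-≤ P? Q? P⇒Q (x ∷ xs) with P? x | Q? x
... | yes p | yes q = ℕ.s≤s (length-filter-≤ P? Q? P⇒Q xs)
... | yes p | no ¬q = contradiction (P⇒Q x p) ¬q
... | no ¬p | yes q = ℕ.m≤n⇒m≤1+n (length-filter-≤ P? Q? P⇒Q xs)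
... | no ¬p | no ¬q = length-filter-≤ P? Q? P⇒Q xs

length-filter-< : {A : Set} {P Q : A → Set} (P? : Decidable P) (Q? : Decidable Q) → (∀ x → P x → Q x) →
                  ∀ {y} xs → y ∈ xs → ¬ P y → Q y → length (filter P? xs) ℕ.< length (filter Q? xs)
length-filter-< P? Q? P⇒Q (x ∷ xs) (here refl) ¬Py Qy with P? x | Q? x
... | yes p | _     = contradiction p ¬Py
... | no _  | yes _ = ℕ.s≤s (length-filter-≤ P? Q? P⇒Q xs)
... | no _  | no ¬q = contradiction Qy ¬q
length-filter-< P? Q? P⇒Q (x ∷ xs) (there y∈) ¬Py Qy with P? x | Q? x
... | yes p | yes q = ℕ.s≤s (length-filter-< P? Q? P⇒Q xs y∈ ¬Py Qy)
... | yes p | no ¬q = contradiction (P⇒Q x p) ¬q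
... | no ¬p | yes q = ℕ.m≤n⇒m≤1+n (length-filter-< P? Q? P⇒Q xs y∈ ¬Py Qy)
... | no ¬p | no ¬q = length-filter-< P? Q? P⇒Q xs y∈ ¬Py Qy

-- Matroids presented by a closure relation

-- The matroid is given by entailment because for hyperplanes in s this is directly a statement
-- about points; the rank is derived from it.
module Matroid
  {E : Set} (_⊢_ : List E → E → Set) (_⊢?_ : ∀ S e → Dec (S ⊢ e))
  (∈⇒⊢ : ∀ {S e} → e ∈ S → S ⊢ e)
  (⊢-trans : ∀ {S T e} → All (T ⊢_) S → S ⊢ e → T ⊢ e)
  (⊢-exchange : ∀ {S e e'} → ¬ (S ⊢ e') → (e ∷ S) ⊢ e' → (e' ∷ S) ⊢ e)
  where

  open import Data.Integer using (_+_; _*_; -_; _-_)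

  infix 4 _⊑_ _≈_ _⊏_ _⊑?_ _≈?_ _⊏?_

  -- A list stands for the flat it spans.  In an arrangement, S ⊑ T means that the subspace cut
  -- out by T lies in the one cut out by S.
  _⊑_ _≈_ _⊏_ : List E → List E → Set
  S ⊑ T = All (T ⊢_) S
  S ≈ T = S ⊑ T × T ⊑ S
  S ⊏ T = S ⊑ T × ¬ (T ⊑ S)

  _⊑?_ : ∀ S T → Dec (S ⊑ T)
  S ⊑? T = all? (T ⊢?_) S

  _≈?_ : ∀ S T → Dec (S ≈ T)
  S ≈? T = (S ⊑? T) ×-dec (T ⊑? S)

  _⊏?_ : ∀ S T → Dec (S ⊏ T)
  S ⊏? T = (S ⊑? T) ×-dec ¬? (T ⊑? S)

  ⊑-refl : ∀ {S} → S ⊑ S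
  ⊑-refl = All.tabulate ∈⇒⊢

  ⊑-trans : ∀ {S T U} → S ⊑ T → T ⊑ U → S ⊑ U
  ⊑-trans S⊑T T⊑U = All.map (⊢-trans T⊑U) S⊑T

  ≈-refl : ∀ {S} → S ≈ S
  ≈-refl = ⊑-refl , ⊑-refl

  ≈-trans : ∀ {S T U} → S ≈ T → T ≈ U → S ≈ U
  ≈-trans (a , b) (c , e) = ⊑-trans a c , ⊑-trans e b

  ⊑-there : ∀ {S T e} → S ⊑ T → S ⊑ e ∷ T
  ⊑-there S⊑T = ⊑-trans S⊑T (All.tabulate (∈⇒⊢ ∘ there))

  ⊑-∷ : ∀ {S T e} → S ⊑ T → e ∷ S ⊑ e ∷ T
  ⊑-∷ S⊑T = ∈⇒⊢ (here refl) ∷ ⊑-there S⊑T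

  ≈-∷ : ∀ {S T e} → S ≈ T → e ∷ S ≈ e ∷ T
  ≈-∷ (a , b) = ⊑-∷ a , ⊑-∷ b

  ⊢⇒≈∷ : ∀ {S e} → S ⊢ e → S ≈ e ∷ S
  ⊢⇒≈∷ S⊢e = ⊑-there ⊑-refl , S⊢e ∷ ⊑-refl

  -- Adjoining an element outside the closure passes to a covering flat, so this is a maximal chain
  -- of flats from `V` to `U`, recorded by the elements adjoined.
  data Chain (V U : List E) : ℕ → Set where
    done : V ≈ U → Chain V U 0
    step : ∀ {n} e → ¬ (V ⊢ e) → Chain (e ∷ V) U n → Chain V U (suc n)

  chain-respˡ : ∀ {V V' U n} → V ≈ V' → Chain V U n → Chain V' U n
  chain-respˡ eq (done e)       = done (≈-trans (swap eq) e)
  chain-respˡ eq (step e ¬⊢ ch) = step e (¬⊢ ∘ ⊢-trans (proj₂ eq)) (chain-respˡ (≈-∷ eq) ch)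

  chain-respʳ : ∀ {V U U' n} → U ≈ U' → Chain V U n → Chain V U' n
  chain-respʳ eq (done e)       = done (≈-trans e eq)
  chain-respʳ eq (step e ¬⊢ ch) = step e ¬⊢ (chain-respʳ eq ch)

  chain-⊑ : ∀ {V U n} → Chain V U n → V ⊑ U
  chain-⊑ (done e)      = proj₁ e
  chain-⊑ (step e _ ch) = All.tail (chain-⊑ ch)

  chain-snoc : ∀ {V U n e} → ¬ (U ⊢ e) → Chain V U n → Chain V (e ∷ U) (suc n)
  chain-snoc ¬⊢ (done eq)        = step _ (¬⊢ ∘ ⊢-trans (proj₁ eq)) (done (≈-∷ eq))
  chain-snoc ¬⊢ (step e' ¬⊢' ch) = step e' ¬⊢' (chain-snoc ¬⊢ ch)

  ⊑-move : ∀ {V e} T → e ∷ T ++ V ⊑ T ++ e ∷ V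
  ⊑-move []      = ⊑-refl
  ⊑-move (x ∷ T) with e⊑ ∷ T⊑ ← ⊑-there {e = x} (⊑-move T) = e⊑ ∷ ∈⇒⊢ (here refl) ∷ T⊑

  -- `T` holds the generators of `U` still to be processed: one already entailed is dropped, any
  -- other becomes a step, and `U ⊑ T ++ V` guarantees that `U` is reached when `T` is exhausted.
  chain-exists : ∀ {V U} T → V ⊑ U → T ⊑ U → U ⊑ T ++ V → ∃ (Chain V U)
  chain-exists []          V⊑U _             U⊑V = 0 , done (V⊑U , U⊑V)
  chain-exists {V} (e ∷ T) V⊑U (U⊢e ∷ T⊑U) U⊑  with V ⊢? e
  ... | yes V⊢e = chain-exists T V⊑U T⊑U
        (⊑-trans U⊑ (⊢-trans (All.tabulate (∈⇒⊢ ∘ ∈-++⁺ʳ T)) V⊢e ∷ ⊑-refl))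
  ... | no  V⊬e with n , ch ← chain-exists T (U⊢e ∷ V⊑U) T⊑U (⊑-trans U⊑ (⊑-move T)) = suc n , step e V⊬e ch

  ∷∷-comm : ∀ {V e e'} → e' ∷ e ∷ V ⊑ e ∷ e' ∷ V
  ∷∷-comm = ∈⇒⊢ (there (here refl)) ∷ ∈⇒⊢ (here refl) ∷ ⊑-there (⊑-there ⊑-refl)

  -- Jordan–Hölder: if two chains start with e and e', either e ∷ V ≈ e' ∷ V
  -- by exchange, or both can be rerouted through e' ∷ e ∷ V.
  chain-unique : ∀ m {V U n} → Chain V U m → Chain V U n → m ≡ n
  chain-unique zero    (done _)       (done _)       = refl
  chain-unique zero    (done eq)      (step e ¬⊢ ch) = contradiction (⊢-trans (proj₂ eq) (All.head (chain-⊑ ch))) ¬⊢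
  chain-unique (suc m) (step e ¬⊢ ch) (done eq)      = contradiction (⊢-trans (proj₂ eq) (All.head (chain-⊑ ch))) ¬⊢
  chain-unique (suc m) {V} {U} (step e ¬⊢ ch) (step {n} e' ¬⊢' ch') with (e ∷ V) ⊢? e'
  ... | yes p = cong suc (chain-unique m ch (chain-respˡ
        ((p ∷ ⊑-there ⊑-refl) , (⊢-exchange ¬⊢' p ∷ ⊑-there ⊑-refl)) ch'))
  ... | no ¬p with k , ch″ ← chain-exists U (All.head (chain-⊑ ch') ∷ chain-⊑ ch) ⊑-refl
                               (All.tabulate (∈⇒⊢ ∘ ∈-++⁺ˡ)) =
    -- The recursion is on the length of the first chain. The rerouted chain from `e' ∷ V` has
    -- length `suc k`, and `m≡`, itself an instance of the induction hypothesis, identifies this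
    -- with `m`.
    cong suc (chain-unique m (subst (Chain (e' ∷ V) U) (sym m≡) (step e (¬p ∘ ⊢-exchange ¬⊢)
                                      (chain-respˡ (∷∷-comm , ∷∷-comm) ch″))) ch')
    where
    m≡ : m ≡ suc k
    m≡ = chain-unique m ch (step e' ¬p ch″)

  rank : List E → ℕ
  rank []      = 0
  rank (e ∷ S) with S ⊢? e
  ... | yes _ = rank S
  ... | no  _ = suc (rank S)

  chain-rank : ∀ S → Chain [] S (rank S)
  chain-rank []      = done ≈-refl
  chain-rank (e ∷ S) with S ⊢? e
  ... | yes p = chain-respʳ (⊢⇒≈∷ p) (chain-rank S)
  ... | no ¬p = chain-snoc ¬p (chain-rank S)

  -- `rank` is computed along a particular list, but it is the length of a chain from `[]`, which
  -- the flat determines.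
  rank-resp : ∀ {S T} → S ≈ T → rank S ≡ rank T
  rank-resp {S} {T} eq = chain-unique (rank S) (chain-respʳ eq (chain-rank S)) (chain-rank T)

  -- Signed and unsigned deletion-restriction.

  sgn : ℕ → ℤ
  sgn zero    = 1ℤ
  sgn (suc n) = - sgn n

  sgn² : ∀ n → sgn n * sgn n ≡ 1ℤ
  sgn² zero    = refl
  sgn² (suc n) = trans (neg² (sgn n)) (sgn² n)
    where
    neg² : ∀ i → - i * - i ≡ i * i
    neg² = ℤ-Solver.solve-∀

  ∣sgn∣ : ∀ n → ∣ sgn n ∣ ≡ 1
  ∣sgn∣ zero    = refl
  ∣sgn∣ (suc n) = trans (ℤ.∣-i∣≡∣i∣ (sgn n)) (∣sgn∣ n)

  ε : List E → ℤ
  ε S = sgn (rank S)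

  ε-∷ : ∀ {S e} → ¬ (S ⊢ e) → ε (e ∷ S) ≡ - ε S
  ε-∷ {S} {e} S⊬e with S ⊢? e
  ... | yes p = contradiction p S⊬e
  ... | no _  = refl

  -- ∑ (-1)^∣S∣ over the sub-lists S of the second argument such that V ++ S spans the same flat as U.
  whitney : List E → List E → List E → ℤ
  whitney V []       U = ⟦ V ≈? U ⟧
  whitney V (e ∷ es) U = whitney V es U - whitney (e ∷ V) es U

  -- The absolute value of whitney: it counts the bases of U over V without broken circuits.
  nbc : List E → List E → List E → ℕ
  nbc V []       U = ∣ ⟦ V ≈? U ⟧ ∣
  nbc V (e ∷ es) U with V ⊢? e
  ... | yes _ = 0
  ... | no  _ = nbc V es U ℕ.+ nbc (e ∷ V) es U

  -- The number of regions cut out by the second list inside the subspace of `V`. It is 0 as soon as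
  -- a hyperplane contains the whole subspace, since no point is then off it.
  chambers : List E → List E → ℕ
  chambers V []       = 1
  chambers V (e ∷ es) with V ⊢? e
  ... | yes _ = 0
  ... | no  _ = chambers V es ℕ.+ chambers (e ∷ V) es

  whitney-resp : ∀ {V V'} es U → V ≈ V' → whitney V es U ≡ whitney V' es U
  whitney-resp {V} {V'} [] U eq = ⟦⟧-cong (V ≈? U) (V' ≈? U) (≈-trans (swap eq)) (≈-trans eq)
  whitney-resp (e ∷ es) U eq = cong₂ _-_ (whitney-resp es U eq) (whitney-resp es U (≈-∷ eq))

  -- If `V` entails `e`, the two terms of the recursion cancel. Otherwise `e ∷ V` has rank one more,
  -- and its sign turns the subtraction into an addition.
  whitney-sign : ∀ V es U → whitney V es U ≡ ε V * ε U * + nbc V es U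
  whitney-sign V [] U = by (V ≈? U)
    where
    by : (V≈U? : Dec (V ≈ U)) → ⟦ V≈U? ⟧ ≡ ε V * ε U * + ∣ ⟦ V≈U? ⟧ ∣
    by (yes eq) = sym (trans (ℤ.*-identityʳ _) (trans (cong (λ n → sgn n * ε U) (rank-resp eq)) (sgn² (rank U))))
    by (no _)   = sym (ℤ.*-zeroʳ (ε V * ε U))
  whitney-sign V (e ∷ es) U with V ⊢? e
  ... | yes p = trans (ℤ.i≡j⇒i-j≡0 (whitney-resp es U (⊢⇒≈∷ p))) (sym (ℤ.*-zeroʳ (ε V * ε U)))
  ... | no ¬p = begin
    whitney V es U - whitney (e ∷ V) es U
      ≡⟨ cong₂ _-_ (whitney-sign V es U) (whitney-sign (e ∷ V) es U) ⟩
    ε V * ε U * + nbc V es U - ε (e ∷ V) * ε U * + nbc (e ∷ V) es U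
      ≡⟨ cong (λ s → ε V * ε U * + nbc V es U - s * ε U * + nbc (e ∷ V) es U) (ε-∷ ¬p) ⟩
    ε V * ε U * + nbc V es U - - ε V * ε U * + nbc (e ∷ V) es U
      ≡⟨ collect (ε V) (ε U) (+ nbc V es U) (+ nbc (e ∷ V) es U) ⟩
    ε V * ε U * (+ nbc V es U + + nbc (e ∷ V) es U) ∎
    where
    open ≡-Reasoning
    collect : ∀ a b c e → a * b * c - - a * b * e ≡ a * b * (c + e)
    collect = ℤ-Solver.solve-∀

  ∣whitney∣ : ∀ V es U → ∣ whitney V es U ∣ ≡ nbc V es U
  ∣whitney∣ V es U = begin
    ∣ whitney V es U ∣                      ≡⟨ cong ∣_∣ (whitney-sign V es U) ⟩
    ∣ ε V * ε U * + nbc V es U ∣            ≡⟨ ℤ.∣i*j∣≡∣i∣*∣j∣ (ε V * ε U) (+ nbc V es U) ⟩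
    ∣ ε V * ε U ∣ ℕ.* nbc V es U            ≡⟨ cong (ℕ._* nbc V es U) (ℤ.∣i*j∣≡∣i∣*∣j∣ (ε V) (ε U)) ⟩
    ∣ ε V ∣ ℕ.* ∣ ε U ∣ ℕ.* nbc V es U      ≡⟨ cong₂ (λ a b → a ℕ.* b ℕ.* nbc V es U) (∣sgn∣ (rank V)) (∣sgn∣ (rank U)) ⟩
    1 ℕ.* nbc V es U                        ≡⟨ ℕ.*-identityˡ _ ⟩
    nbc V es U                              ∎
    where open ≡-Reasoning

  -- Sums over representatives of the flats, and Möbius inversion.

  module Flats
    (Ok : E → Set) (flats : List (List E))
    (cover : ∀ S → All Ok S → ∃ λ S' → S' ∈ flats × S ≈ S')
    (distinct : AllPairsDistinct _≈_ flats)
    where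

    ∑-≈ : (f : List E → ℤ) → ∀ {V W} → W ∈ flats → V ≈ W → ∑ (λ w → f w * ⟦ V ≈? w ⟧) flats ≡ f W
    ∑-≈ f {V} {W} = go distinct
      where
      go : ∀ {ws} → AllPairsDistinct _≈_ ws → W ∈ ws → V ≈ W → ∑ (λ w → f w * ⟦ V ≈? w ⟧) ws ≡ f W
      go {w ∷ ws} (w≉ ∷ dist) (here refl) eq = trans
        (cong₂ _+_ (trans (cong (f W *_) (⟦⟧-yes (V ≈? W) eq)) (ℤ.*-identityʳ (f W)))
                   (∑-zero ws λ w' w'∈ → trans
                     (cong (f w' *_) (⟦⟧-no (V ≈? w') λ eq' → All.lookup w≉ w'∈ (≈-trans (swap eq) eq')))
                     (ℤ.*-zeroʳ (f w'))))
        (ℤ.+-identityʳ (f W))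
      go {w ∷ ws} (w≉ ∷ dist) (there W∈) eq = trans
        (cong₂ _+_ (trans (cong (f w *_) (⟦⟧-no (V ≈? w) λ eq' → All.lookup w≉ W∈ (≈-trans (swap eq') eq)))
                          (ℤ.*-zeroʳ (f w)))
                   (go dist W∈ eq))
        (ℤ.+-identityˡ (f W))

    ∑-⊑-split : (f : List E → ℤ) → ∀ {u} → u ∈ flats →
                ∑ (λ w → f w * ⟦ w ⊑? u ⟧) flats ≡ f u + ∑ (λ w → f w * ⟦ w ⊏? u ⟧) flats
    ∑-⊑-split f {u} u∈ = trans
      (∑-cong flats λ w _ → trans (cong (f w *_) (split w)) (ℤ.*-distribˡ-+ (f w) ⟦ u ≈? w ⟧ ⟦ w ⊏? u ⟧))
      (trans (∑-+ (λ w → f w * ⟦ u ≈? w ⟧) (λ w → f w * ⟦ w ⊏? u ⟧) flats)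
             (cong (_+ ∑ (λ w → f w * ⟦ w ⊏? u ⟧) flats) (∑-≈ f u∈ ≈-refl)))
      where
      split : ∀ w → ⟦ w ⊑? u ⟧ ≡ ⟦ u ≈? w ⟧ + ⟦ w ⊏? u ⟧
      split w with w ⊑? u | u ⊑? w
      ... | yes _ | yes _ = refl
      ... | yes _ | no  _ = refl
      ... | no  _ | yes _ = refl
      ... | no  _ | no  _ = refl

    -- Induction on the number of representatives strictly below `u`: there `f` and `g` agree, so
    -- equal sums leave equal values at `u`. It is confined to flats below `U` because the
    -- comparison with `whitney [] U` is available only there.
    möbius-unique : (f g : List E → ℤ) (U : List E) →
                    (∀ u → u ∈ flats → u ⊑ U →
                      ∑ (λ w → f w * ⟦ w ⊑? u ⟧) flats ≡ ∑ (λ w → g w * ⟦ w ⊑? u ⟧) flats) →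
                    ∀ u → u ∈ flats → u ⊑ U → f u ≡ g u
    möbius-unique f g U eq u u∈ u⊑U = go (suc (size u)) u u∈ u⊑U ℕ.≤-refl
      where
      size : List E → ℕ
      size u = length (filter (_⊏? u) flats)
      go : ∀ n u → u ∈ flats → u ⊑ U → size u ℕ.< n → f u ≡ g u
      go (suc n) u u∈ u⊑U (ℕ.s≤s size≤n) = ∙-cancelʳ ℤ.+-0-abelianGroup (∑ (λ w → g w * ⟦ w ⊏? u ⟧) flats) (f u) (g u) (begin
        f u + ∑ (λ w → g w * ⟦ w ⊏? u ⟧) flats   ≡⟨ cong (_+_ (f u)) (∑-cong flats λ w w∈ → sym (lower w w∈)) ⟩
        f u + ∑ (λ w → f w * ⟦ w ⊏? u ⟧) flats   ≡⟨ sym (∑-⊑-split f u∈) ⟩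
        ∑ (λ w → f w * ⟦ w ⊑? u ⟧) flats         ≡⟨ eq u u∈ u⊑U ⟩
        ∑ (λ w → g w * ⟦ w ⊑? u ⟧) flats         ≡⟨ ∑-⊑-split g u∈ ⟩
        g u + ∑ (λ w → g w * ⟦ w ⊏? u ⟧) flats   ∎)
        where
        open ≡-Reasoning
        size< : ∀ w → w ∈ flats → w ⊏ u → size w ℕ.< size u
        size< w w∈ (w⊑u , u⋢w) = length-filter-< (_⊏? w) (_⊏? u)
          (λ v (v⊑w , w⋢v) → ⊑-trans v⊑w w⊑u , λ u⊑v → u⋢w (⊑-trans u⊑v v⊑w))
          flats w∈ (λ (_ , w⋢w) → w⋢w ⊑-refl) (w⊑u , u⋢w)
        lower : ∀ w → w ∈ flats → f w * ⟦ w ⊏? u ⟧ ≡ g w * ⟦ w ⊏? u ⟧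
        lower w w∈ = by (w ⊏? u)
          where
          by : (d : Dec (w ⊏ u)) → f w * ⟦ d ⟧ ≡ g w * ⟦ d ⟧
          by (yes w⊏u) = cong (_* 1ℤ) (go n w w∈ (⊑-trans (proj₁ w⊏u) u⊑U) (ℕ.<-≤-trans (size< w w∈ w⊏u) size≤n))
          by (no _)    = trans (ℤ.*-zeroʳ (f w)) (sym (ℤ.*-zeroʳ (g w)))

    ∑-≈-resp : (f : List E → ℤ) → (∀ {S T} → S ≈ T → f S ≡ f T) → ∀ {V} → All Ok V →
               ∑ (λ w → f w * ⟦ V ≈? w ⟧) flats ≡ f V
    ∑-≈-resp f resp {V} ok with W , W∈ , V≈W ← cover V ok = trans (∑-≈ f W∈ V≈W) (sym (resp V≈W))

    ⟦⊑⟧-resp : ∀ U {S T} → S ≈ T → ⟦ S ⊑? U ⟧ ≡ ⟦ T ⊑? U ⟧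
    ⟦⊑⟧-resp U {S} {T} (a , b) = ⟦⟧-cong (S ⊑? U) (T ⊑? U) (⊑-trans b) (⊑-trans a)

    -- Sub-lists containing an element of es below u cancel in pairs.
    ∑-whitney : ∀ V es → All Ok V → All Ok es → ∀ u →
                ∑ (λ w → whitney V es w * ⟦ w ⊑? u ⟧) flats ≡ ⟦ (V ⊑? u) ×-dec ¬? (any? (u ⊢?_) es) ⟧
    ∑-whitney V [] okV _ u = trans
      (∑-cong flats λ w _ → ℤ.*-comm ⟦ V ≈? w ⟧ ⟦ w ⊑? u ⟧)
      (trans (∑-≈-resp (λ w → ⟦ w ⊑? u ⟧) (⟦⊑⟧-resp u) okV)
             (⟦⟧-cong (V ⊑? u) ((V ⊑? u) ×-dec ¬? (any? (u ⊢?_) [])) (λ p → p , λ ()) proj₁))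
    ∑-whitney V (e ∷ es) okV (oke ∷ okes) u = begin
      ∑ (λ w → (whitney V es w - whitney (e ∷ V) es w) * ⟦ w ⊑? u ⟧) flats
        ≡⟨ ∑-cong flats (λ w _ → distrib (whitney V es w) (whitney (e ∷ V) es w) ⟦ w ⊑? u ⟧) ⟩
      ∑ (λ w → whitney V es w * ⟦ w ⊑? u ⟧ - whitney (e ∷ V) es w * ⟦ w ⊑? u ⟧) flats
        ≡⟨ ∑-- (λ w → whitney V es w * ⟦ w ⊑? u ⟧) (λ w → whitney (e ∷ V) es w * ⟦ w ⊑? u ⟧) flats ⟩
      ∑ (λ w → whitney V es w * ⟦ w ⊑? u ⟧) flats - ∑ (λ w → whitney (e ∷ V) es w * ⟦ w ⊑? u ⟧) flats
        ≡⟨ cong₂ _-_ (∑-whitney V es okV okes u) (∑-whitney (e ∷ V) es (oke ∷ okV) okes u) ⟩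
      ⟦ (V ⊑? u) ×-dec ¬? (any? (u ⊢?_) es) ⟧ - ⟦ (e ∷ V ⊑? u) ×-dec ¬? (any? (u ⊢?_) es) ⟧
        ≡⟨ cancel ⟩
      ⟦ (V ⊑? u) ×-dec ¬? (any? (u ⊢?_) (e ∷ es)) ⟧ ∎
      where
      open ≡-Reasoning
      distrib : ∀ a b c → (a - b) * c ≡ a * c - b * c
      distrib = ℤ-Solver.solve-∀
      cancel : ⟦ (V ⊑? u) ×-dec ¬? (any? (u ⊢?_) es) ⟧ - ⟦ (e ∷ V ⊑? u) ×-dec ¬? (any? (u ⊢?_) es) ⟧
               ≡ ⟦ (V ⊑? u) ×-dec ¬? (any? (u ⊢?_) (e ∷ es)) ⟧
      cancel with u ⊢? e | V ⊑? u | any? (u ⊢?_) es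
      ... | yes _ | yes _ | yes _ = refl
      ... | yes _ | yes _ | no _  = refl
      ... | yes _ | no _  | yes _ = refl
      ... | yes _ | no _  | no _  = refl
      ... | no _  | yes _ | yes _ = refl
      ... | no _  | yes _ | no _  = refl
      ... | no _  | no _  | yes _ = refl
      ... | no _  | no _  | no _  = refl

    -- `nbc` and `chambers` follow the same recursion; at the empty list exactly one representative
    -- is equivalent to `V`, and it lies below `U`.
    ∑-nbc : ∀ V es U → All Ok V → All Ok es → V ⊑ U → es ⊑ U →
            ∑ (λ u → + nbc V es u * ⟦ u ⊑? U ⟧) flats ≡ + chambers V es
    ∑-nbc V [] U okV _ V⊑U _ = begin
      ∑ (λ u → + ∣ ⟦ V ≈? u ⟧ ∣ * ⟦ u ⊑? U ⟧) flats ≡⟨ ∑-cong flats (λ u _ → flip u) ⟩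
      ∑ (λ u → ⟦ u ⊑? U ⟧ * ⟦ V ≈? u ⟧) flats       ≡⟨ ∑-≈-resp (λ w → ⟦ w ⊑? U ⟧) (⟦⊑⟧-resp U) okV ⟩
      ⟦ V ⊑? U ⟧                                    ≡⟨ ⟦⟧-yes (V ⊑? U) V⊑U ⟩
      1ℤ                                            ∎
      where
      open ≡-Reasoning
      flip : ∀ u → + ∣ ⟦ V ≈? u ⟧ ∣ * ⟦ u ⊑? U ⟧ ≡ ⟦ u ⊑? U ⟧ * ⟦ V ≈? u ⟧
      flip u = by (V ≈? u)
        where
        by : (V≈u? : Dec (V ≈ u)) → + ∣ ⟦ V≈u? ⟧ ∣ * ⟦ u ⊑? U ⟧ ≡ ⟦ u ⊑? U ⟧ * ⟦ V≈u? ⟧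
        by (yes _) = ℤ.*-comm 1ℤ ⟦ u ⊑? U ⟧
        by (no _)  = ℤ.*-comm 0ℤ ⟦ u ⊑? U ⟧
    ∑-nbc V (e ∷ es) U okV (oke ∷ okes) V⊑U (U⊢e ∷ es⊑U) with V ⊢? e
    ... | yes _ = ∑-zero flats λ u _ → ℤ.*-zeroˡ ⟦ u ⊑? U ⟧
    ... | no  _ = trans
      (∑-cong flats λ u _ → ℤ.*-distribʳ-+ ⟦ u ⊑? U ⟧ (+ nbc V es u) (+ nbc (e ∷ V) es u))
      (trans (∑-+ (λ u → + nbc V es u * ⟦ u ⊑? U ⟧) (λ u → + nbc (e ∷ V) es u * ⟦ u ⊑? U ⟧) flats)
             (cong₂ _+_ (∑-nbc V es U okV okes V⊑U es⊑U)
                        (∑-nbc (e ∷ V) es U (oke ∷ okV) okes (U⊢e ∷ V⊑U) es⊑U)))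

    module Möbius
      (μ : List E → ℤ)
      (μ-bottom : ∀ u → u ∈ flats → u ⊑ [] → μ u ≡ 1ℤ)
      (μ-rec : ∀ u → u ∈ flats → ¬ (u ⊑ []) → μ u + ∑ (λ w → μ w * ⟦ w ⊏? u ⟧) flats ≡ 0ℤ)
      where

      ∑-μ-flat : ∀ u → u ∈ flats → ∑ (λ w → μ w * ⟦ w ⊑? u ⟧) flats ≡ ⟦ u ⊑? [] ⟧
      ∑-μ-flat u u∈ = trans (∑-⊑-split μ u∈) (by (u ⊑? []))
        where
        by : (u⊑? : Dec (u ⊑ [])) → μ u + ∑ (λ w → μ w * ⟦ w ⊏? u ⟧) flats ≡ ⟦ u⊑? ⟧
        by (yes u⊑[]) = cong₂ _+_ (μ-bottom u u∈ u⊑[]) (∑-zero flats λ w _ → trans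
          (cong (μ w *_) (⟦⟧-no (w ⊏? u) λ (_ , u⋢w) → u⋢w (⊑-trans u⊑[] []))) (ℤ.*-zeroʳ (μ w)))
        by (no u⋢[]) = μ-rec u u∈ u⋢[]

      ∑-μ : ∀ U → All Ok U → ∑ (λ w → μ w * ⟦ w ⊑? U ⟧) flats ≡ ⟦ U ⊑? [] ⟧
      ∑-μ U ok with u , u∈ , (U⊑u , u⊑U) ← cover U ok = trans
        (∑-cong flats λ w _ → cong (μ w *_) (⟦⟧-cong (w ⊑? U) (w ⊑? u) (λ p → ⊑-trans p U⊑u) (λ p → ⊑-trans p u⊑U)))
        (trans (∑-μ-flat u u∈) (⟦⊑⟧-resp [] (u⊑U , U⊑u)))

      -- Whitney's theorem, for the flats of the localization at U.
      μ-whitney : ∀ U → All Ok U → (∀ u → u ∈ flats → u ⊑ U → ∀ {e} → e ∈ u → e ∈ U) →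
                  (∀ {e} → e ∈ U → ¬ ([] ⊢ e)) →
                  ∀ u → u ∈ flats → u ⊑ U → μ u ≡ whitney [] U u
      μ-whitney U ok ⊑⇒∈ noloop = möbius-unique μ (whitney [] U) U λ u u∈ u⊑U →
        trans (∑-μ-flat u u∈) (trans
          (⟦⟧-cong (u ⊑? []) (([] ⊑? u) ×-dec ¬? (any? (u ⊢?_) U))
            -- If `u ⊑ []`, a member of `U` entailed by `u` would be a loop. Conversely the members
            -- of `u` lie in `U`, so if none of `U` is entailed, `u` is empty.
            (λ u⊑[] → [] , λ any → let e , e∈ , u⊢e = find any in noloop e∈ (⊢-trans u⊑[] u⊢e))
            (λ (_ , none) → All.tabulate λ e∈ → contradiction (lose (⊑⇒∈ u u∈ u⊑U e∈) (∈⇒⊢ e∈)) none))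
          (sym (∑-whitney [] U [] ok u)))

      ∑-∣μ∣ : ∀ U → All Ok U → (∀ u → u ∈ flats → u ⊑ U → ∀ {e} → e ∈ u → e ∈ U) →
              (∀ {e} → e ∈ U → ¬ ([] ⊢ e)) →
              ∑ (λ u → + ∣ μ u ∣ * ⟦ u ⊑? U ⟧) flats ≡ + chambers [] U
      ∑-∣μ∣ U ok ⊑⇒∈ noloop = trans (∑-cong flats λ u u∈ → local u u∈ (u ⊑? U)) (∑-nbc [] U U [] ok [] ⊑-refl)
        where
        local : ∀ u → u ∈ flats → (d : Dec (u ⊑ U)) → + ∣ μ u ∣ * ⟦ d ⟧ ≡ + nbc [] U u * ⟦ d ⟧
        local u u∈ (yes u⊑U) = cong (λ n → + n * 1ℤ)
          (trans (cong ∣_∣ (μ-whitney U ok ⊑⇒∈ noloop u u∈ u⊑U)) (∣whitney∣ [] U u))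
        local u u∈ (no _)    = trans (ℤ.*-zeroʳ (+ ∣ μ u ∣)) (sym (ℤ.*-zeroʳ (+ nbc [] U u)))

-- Sides of hyperplanes and small perturbations

module _ where

  open import Data.Rational using (_+_; _*_; -_; _-_; _<_; _≤_)

  ℚ-ring : AlmostCommutativeRing _ _
  ℚ-ring = fromCommutativeRing ℚ.+-*-commutativeRing λ p → dec⇒maybe (0ℚ ℚ.≟ p)

  0<q-p : ∀ {p q} → p < q → 0ℚ < q - p
  0<q-p {p} {q} p<q = subst (_< q - p) (ℚ.+-inverseʳ p) (ℚ.+-monoˡ-< (- p) p<q)

  0<q-p⁻¹ : ∀ {p q} → 0ℚ < q - p → p < q
  0<q-p⁻¹ {p} {q} lt = subst₂ _<_ (ℚ.+-identityˡ p) (eq q p) (ℚ.+-monoˡ-< p lt)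
    where
    eq : ∀ q p → q - p + p ≡ q
    eq = solve-∀ ℚ-ring

  ≮∧≢⇒> : ∀ {p q} → ¬ (p < q) → p ≢ q → q < p
  ≮∧≢⇒> {p} {q} p≮q p≢q with ℚ.<-cmp p q
  ... | tri< p<q _ _ = contradiction p<q p≮q
  ... | tri≈ _ p≡q _ = contradiction p≡q p≢q
  ... | tri> _ _ q<p = q<p

  *-pos : ∀ {p q} → 0ℚ < p → 0ℚ < q → 0ℚ < p * q
  *-pos {p} {q} 0<p 0<q =
    ℚ.positive⁻¹ (p * q) {{ℚ.pos*pos⇒pos p {{ℚ.positive 0<p}} q {{ℚ.positive 0<q}}}}

  *-cancelˡ : ∀ {a p q} → a ≢ 0ℚ → a * p ≡ a * q → p ≡ q
  *-cancelˡ {a} {p} {q} a≢0 eq = trans (sym (undo p)) (trans (cong (ℚ.1/ a *_) eq) (undo q))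
    where
    instance _ = ℚ.≢-nonZero a≢0
    undo : ∀ r → ℚ.1/ a * (a * r) ≡ r
    undo r = trans (sym (ℚ.*-assoc (ℚ.1/ a) a r)) (trans (cong (_* r) (ℚ.*-inverseˡ a)) (ℚ.*-identityˡ r))

  p-q≢0 : ∀ {p q} → p ≢ q → p - q ≢ 0ℚ
  p-q≢0 {p} {q} p≢q eq = p≢q (trans (sym (undo p q)) (trans (cong (_+ q) eq) (ℚ.+-identityˡ q)))
    where
    undo : ∀ p q → p - q + q ≡ p
    undo = solve-∀ ℚ-ring

  -- "For all sufficiently small positive δ": unlike a single witness, this is closed under finite
  -- conjunction, so one δ can serve all coordinates and hyperplanes.
  Small : (ℚ → Set) → Set
  Small P = ∃ λ δ → 0ℚ < δ × (∀ δ' → 0ℚ < δ' → δ' ≤ δ → P δ')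

  small-witness : ∀ {P} → Small P → ∃ λ δ → 0ℚ < δ × P δ
  small-witness (δ , 0<δ , p) = δ , 0<δ , p δ 0<δ ℚ.≤-refl

  small-map : ∀ {P Q : ℚ → Set} → (∀ δ → 0ℚ < δ → P δ → Q δ) → Small P → Small Q
  small-map f (δ , 0<δ , p) = δ , 0<δ , λ δ' 0<δ' δ'≤δ → f δ' 0<δ' (p δ' 0<δ' δ'≤δ)

  small-× : ∀ {P Q : ℚ → Set} → Small P → Small Q → Small (λ δ → P δ × Q δ)
  small-× (δ , 0<δ , p) (η , 0<η , q) with ℚ.≤-total δ η
  ... | inj₁ δ≤η = δ , 0<δ , λ δ' 0<δ' δ'≤δ → p δ' 0<δ' δ'≤δ , q δ' 0<δ' (ℚ.≤-trans δ'≤δ δ≤η)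
  ... | inj₂ η≤δ = η , 0<η , λ δ' 0<δ' δ'≤η → p δ' 0<δ' (ℚ.≤-trans δ'≤η η≤δ) , q δ' 0<δ' δ'≤η

  small-∀ : ∀ {n} {P : Fin n → ℚ → Set} → (∀ i → Small (P i)) → Small (λ δ → ∀ i → P i δ)
  small-∀ {zero}  _  = 1ℚ , ℚ.positive⁻¹ 1ℚ , λ _ _ _ ()
  small-∀ {suc n} sm = small-map (λ { δ _ (p , ps) Fin.zero → p ; δ _ (p , ps) (Fin.suc i) → ps i })
                                 (small-× (sm Fin.zero) (small-∀ (sm ∘ Fin.suc)))

  small-All : ∀ {A : Set} {P : A → ℚ → Set} {xs} → All (λ x → Small (P x)) xs → Small (λ δ → All (λ x → P x δ) xs)
  small-All []         = 1ℚ , ℚ.positive⁻¹ 1ℚ , λ _ _ _ → []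
  small-All (sm ∷ sms) = small-map (λ _ _ (p , ps) → p ∷ ps) (small-× sm (small-All sms))

  small-linear : ∀ {a} b → 0ℚ < a → Small (λ δ → 0ℚ < a + δ * b)
  -- δ ≤ a / D with D = 1 + |b| > -b gives δ · (-b) < δ · D ≤ a; the summand 1 makes D positive and
  -- the bound strict.
  small-linear {a} b 0<a = a * ℚ.1/ D , *-pos 0<a (ℚ.positive⁻¹ (ℚ.1/ D) {{ℚ.1/pos⇒pos D}}) , bound
    where
    D = 1ℚ + ℚ.∣ b ∣
    instance
      posD : ℚ.Positive D
      posD = ℚ.pos+nonNeg⇒pos 1ℚ ℚ.∣ b ∣ {{ℚ.∣-∣-nonNeg b}}
      nzD : ℚ.NonZero D
      nzD = ℚ.pos⇒nonZero D
    -b<D : - b < D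
    -b<D = subst (- b <_) (ℚ.+-comm ℚ.∣ b ∣ 1ℚ)
      (ℚ.≤-<-trans (subst (- b ≤_) (ℚ.∣-p∣≡∣p∣ b) (p≤∣p∣ (- b)))
                   (subst (_< ℚ.∣ b ∣ + 1ℚ) (ℚ.+-identityʳ ℚ.∣ b ∣) (ℚ.+-monoʳ-< ℚ.∣ b ∣ (ℚ.positive⁻¹ 1ℚ))))
      where
      p≤∣p∣ : ∀ p → p ≤ ℚ.∣ p ∣
      p≤∣p∣ p with ℚ.≤-total 0ℚ p
      ... | inj₁ 0≤p = ℚ.≤-reflexive (sym (ℚ.0≤p⇒∣p∣≡p 0≤p))
      ... | inj₂ p≤0 = ℚ.≤-trans p≤0 (ℚ.0≤∣p∣ p)
    bound : ∀ δ → 0ℚ < δ → δ ≤ a * ℚ.1/ D → 0ℚ < a + δ * b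
    bound δ 0<δ δ≤ = subst (0ℚ <_) (eq a δ b) (0<q-p (begin-strict
      δ * - b          <⟨ ℚ.*-monoʳ-<-pos δ {{ℚ.positive 0<δ}} -b<D ⟩
      δ * D            ≤⟨ ℚ.*-monoʳ-≤-nonNeg D {{ℚ.pos⇒nonNeg D}} δ≤ ⟩
      a * ℚ.1/ D * D   ≡⟨ trans (ℚ.*-assoc a (ℚ.1/ D) D) (trans (cong (a *_) (ℚ.*-inverseˡ D)) (ℚ.*-identityʳ a)) ⟩
      a                ∎))
      where
      open ℚ.≤-Reasoning
      eq : ∀ a δ b → a - δ * - b ≡ a + δ * b
      eq = solve-∀ ℚ-ring

  eval-cong : ∀ {d} (c : LinForm d) {x y : Pt d} → (∀ i → x i ≡ y i) → eval c x ≡ eval c y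
  eval-cong {zero}  c eq = refl
  eval-cong {suc d} c eq = cong₂ _+_ (cong (c Fin.zero *_) (eq Fin.zero)) (eval-cong (c ∘ Fin.suc) (eq ∘ Fin.suc))

  -- Both coefficients are free, so one closure lemma covers perturbations, crossing points of
  -- hyperplanes and reflections.
  comb : ∀ {d} → ℚ → Pt d → ℚ → Pt d → Pt d
  comb a x b y i = a * x i + b * y i

  eval-comb : ∀ {d} (c : LinForm d) a x b y → eval c (comb a x b y) ≡ a * eval c x + b * eval c y
  eval-comb {zero}  c a x b y = sym (trans (cong₂ _+_ (ℚ.*-zeroʳ a) (ℚ.*-zeroʳ b)) (ℚ.+-identityˡ 0ℚ))
  eval-comb {suc d} c a x b y = trans
    (cong (_+_ (c Fin.zero * (a * x Fin.zero + b * y Fin.zero))) (eval-comb (c ∘ Fin.suc) a (x ∘ Fin.suc) b (y ∘ Fin.suc)))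
    (eq (c Fin.zero) a (x Fin.zero) b (y Fin.zero) (eval (c ∘ Fin.suc) (x ∘ Fin.suc)) (eval (c ∘ Fin.suc) (y ∘ Fin.suc)))
    where
    eq : ∀ c a x b y X Y → c * (a * x + b * y) + (a * X + b * Y) ≡ a * (c * x + X) + b * (c * y + Y)
    eq = solve-∀ ℚ-ring

  eval-scale : ∀ {d} (c : LinForm d) a x → eval c (λ i → a * x i) ≡ a * eval c x
  eval-scale c a x = trans
    (eval-cong c λ i → sym (drop a (x i)))
    (trans (eval-comb c a x 0ℚ x) (drop a (eval c x)))
    where
    drop : ∀ a p → a * p + 0ℚ * p ≡ a * p
    drop a p = trans (cong (_+_ (a * p)) (ℚ.*-zeroˡ p)) (ℚ.+-identityʳ (a * p))

  SameSide : ∀ {d} → Pair d → Pt d → Pt d → Set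
  SameSide (j , k) x y = (x j < x k × y j < y k) ⊎ (x k < x j × y k < y j)

  Generic : ∀ {d} → List (Pair d) → Pt d → Set
  Generic hs x = All (λ h → ¬ OnH h x) hs

  side : ∀ {d} → Pt d → Pair d → Bool
  side x (j , k) = does (x j ℚ.<? x k)

  sides : ∀ {d} → List (Pair d) → Pt d → List Bool
  sides hs x = map (side x) hs

  module _ {d} {x y : Pt d} where

    sameSide-sym : ∀ h → SameSide h x y → SameSide h y x
    sameSide-sym h (inj₁ (p , q)) = inj₁ (q , p)
    sameSide-sym h (inj₂ (p , q)) = inj₂ (q , p)

    sameSide⇒generic : ∀ h → SameSide h x y → ¬ OnH h y
    sameSide⇒generic h (inj₁ (_ , lt)) eq = ℚ.<⇒≢ lt eq
    sameSide⇒generic h (inj₂ (_ , lt)) eq = ℚ.<⇒≢ lt (sym eq)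

    sameSide⇒side : ∀ h → SameSide h x y → side x h ≡ side y h
    sameSide⇒side (j , k) (inj₁ (p , q)) = trans (dec-true (x j ℚ.<? x k) p) (sym (dec-true (y j ℚ.<? y k) q))
    sameSide⇒side (j , k) (inj₂ (p , q)) =
      trans (dec-false (x j ℚ.<? x k) (ℚ.<-asym p)) (sym (dec-false (y j ℚ.<? y k) (ℚ.<-asym q)))

    side⇒sameSide : ∀ h → ¬ OnH h x → ¬ OnH h y → side x h ≡ side y h → SameSide h x y
    side⇒sameSide (j , k) x∉ y∉ = by (x j ℚ.<? x k) (y j ℚ.<? y k)
      where
      by : (p? : Dec (x j < x k)) (q? : Dec (y j < y k)) → does p? ≡ does q? → SameSide (j , k) x y
      by (yes p) (yes q) _ = inj₁ (p , q)
      by (no ¬p) (no ¬q) _ = inj₂ (≮∧≢⇒> ¬p x∉ , ≮∧≢⇒> ¬q y∉)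

    sides⇒sameSide : ∀ hs → Generic hs x → Generic hs y → sides hs x ≡ sides hs y → All (λ h → SameSide h x y) hs
    sides⇒sameSide []       _        _        _  = []
    sides⇒sameSide (h ∷ hs) (p ∷ ps) (q ∷ qs) eq =
      side⇒sameSide h p q (∷-injectiveˡ eq) ∷ sides⇒sameSide hs ps qs (∷-injectiveʳ eq)

    sameSide⇒sides : ∀ {hs} → All (λ h → SameSide h x y) hs → Generic hs y × sides hs x ≡ sides hs y
    sameSide⇒sides []       = [] , refl
    sameSide⇒sides (s ∷ ss) with g , eq ← sameSide⇒sides ss = sameSide⇒generic _ s ∷ g , cong₂ _∷_ (sameSide⇒side _ s) eq

  module _ {d} {x y : Pt d} where

    sameSide-comb : ∀ {a b} → 0ℚ < a → 0ℚ < b → ∀ h → SameSide h x y → SameSide h x (comb a x b y)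
    sameSide-comb {a} {b} 0<a 0<b (j , k) (inj₁ (p , q)) = inj₁ (p , ℚ.+-mono-<
      (ℚ.*-monoʳ-<-pos a {{ℚ.positive 0<a}} p) (ℚ.*-monoʳ-<-pos b {{ℚ.positive 0<b}} q))
    sameSide-comb {a} {b} 0<a 0<b (j , k) (inj₂ (p , q)) = inj₂ (p , ℚ.+-mono-<
      (ℚ.*-monoʳ-<-pos a {{ℚ.positive 0<a}} p) (ℚ.*-monoʳ-<-pos b {{ℚ.positive 0<b}} q))

    comb-<-small : ∀ {j k} → x j < x k → Small (λ δ → comb 1ℚ x δ y j < comb 1ℚ x δ y k)
    comb-<-small {j} {k} p = small-map
      (λ δ _ lt → 0<q-p⁻¹ (subst (0ℚ <_) (eq δ (x k) (x j) (y k) (y j)) lt))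
      (small-linear (y k - y j) (0<q-p p))
      where
      eq : ∀ δ xk xj yk yj → xk - xj + δ * (yk - yj) ≡ 1ℚ * xk + δ * yk - (1ℚ * xj + δ * yj)
      eq = solve-∀ ℚ-ring

    sameSide-small : ∀ h → ¬ OnH h x → Small (λ δ → SameSide h x (comb 1ℚ x δ y))
    sameSide-small (j , k) x∉ with ℚ.<-cmp (x j) (x k)
    ... | tri< p _ _ = small-map (λ _ _ q → inj₁ (p , q)) (comb-<-small p)
    ... | tri≈ _ e _ = contradiction e x∉
    ... | tri> _ _ p = small-map (λ _ _ q → inj₂ (p , q)) (comb-<-small p)

    sameSide-onH : ∀ {δ} → 0ℚ < δ → ∀ h → OnH h x → ¬ OnH h y → SameSide h y (comb 1ℚ x δ y)
    sameSide-onH {δ} 0<δ (j , k) x∈ y∉ with ℚ.<-cmp (y j) (y k)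
    ... | tri< p _ _ = inj₁ (p , ℚ.+-mono-≤-< (ℚ.≤-reflexive (cong (1ℚ *_) x∈)) (ℚ.*-monoʳ-<-pos δ {{ℚ.positive 0<δ}} p))
    ... | tri≈ _ e _ = contradiction e y∉
    ... | tri> _ _ p = inj₂ (p , ℚ.+-mono-≤-< (ℚ.≤-reflexive (cong (1ℚ *_) (sym x∈))) (ℚ.*-monoʳ-<-pos δ {{ℚ.positive 0<δ}} p))

-- The arrangement 𝓗 in s

onH? : ∀ {d} h (x : Pt d) → Dec (OnH h x)
onH? (j , k) x = x j ℚ.≟ x k

module Arrangement {d m} (fs : Fin m → LinForm d) (weightZero : ∀ i → WeightZero (fs i)) where

  open import Data.Rational using (_+_; _*_; -_; _-_; _<_)

  infix 4 _⊨_

  -- Ranges over the whole flat in s, not over its part in P°: linearity is what makes exchange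
  -- provable. `subU⇒⊨` and `⊨⇒subU` translate to inclusion inside P°.
  _⊨_ : List (Pair d) → Pair d → Set
  S ⊨ h = ∀ x → InFlat fs S x → OnH h x

  onH-comb : ∀ {a x b y} (h : Pair d) → OnH h x → OnH h y → OnH h (comb a x b y)
  onH-comb {a} {x} {b} {y} h = cong₂ λ p q → a * p + b * q

  inS-comb : ∀ {a x b y} → InS fs x → InS fs y → InS fs (comb a x b y)
  inS-comb {a} {x} {b} {y} x∈ y∈ i = trans (eval-comb (fs i) a x b y)
    (trans (cong₂ (λ p q → a * p + b * q) (x∈ i) (y∈ i))
           (trans (cong₂ _+_ (ℚ.*-zeroʳ a) (ℚ.*-zeroʳ b)) (ℚ.+-identityˡ 0ℚ)))

  inFlat-comb : ∀ {S a x b y} → InFlat fs S x → InFlat fs S y → InFlat fs S (comb a x b y)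
  inFlat-comb {a = a} {x} {b} {y} (sx , hx) (sy , hy) =
    inS-comb {a} {x} {b} {y} sx sy , All.zipWith (λ {h} (p , q) → onH-comb {a} {x} {b} {y} h p q) (hx , hy)

  -- Weight zero enters here: multiples of (1, ..., 1) lie in s, and they lie on every h_jk.
  inFlat-const : ∀ {S} q → InFlat fs S (λ _ → q)
  inFlat-const q = (λ i → trans (eval-cong (fs i) λ _ → sym (ℚ.*-identityʳ q))
    (trans (eval-scale (fs i) q (λ _ → 1ℚ)) (trans (cong (q *_) (weightZero i)) (ℚ.*-zeroʳ q))))
    , All.tabulate λ _ → refl

  -- The corners (0, ..., 0) and (1, ..., 1) belong to P. If some x_i were 0, prolonging the segment
  -- from (1, ..., 1) beyond x would leave the cube; if some x_i were 1, likewise from the origin.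
  inP°⇒open : ∀ {x} → InP° fs x → OpenCube x × InS fs x
  inP°⇒open {x} ((cube , x∈) , extend) = (λ i → pos i , lt1 i) , x∈
    where
    origin = extend (λ _ → 0ℚ) ((λ i → ℚ.≤-refl , ℚ.<⇒≤ (ℚ.positive⁻¹ 1ℚ)) , proj₁ (inFlat-const {[]} 0ℚ))
    ones   = extend (λ _ → 1ℚ) ((λ i → ℚ.<⇒≤ (ℚ.positive⁻¹ 1ℚ) , ℚ.≤-refl) , proj₁ (inFlat-const {[]} 1ℚ))
    pos : ∀ i → 0ℚ < x i
    pos i = ≮∧≢⇒> (λ x<0 → ℚ.<-irrefl refl (ℚ.<-≤-trans x<0 (proj₁ (cube i)))) λ xi≡0 →
      let ε , 0<ε , (cube' , _) = ones in
      ℚ.<-irrefl refl (ℚ.<-≤-trans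
        (subst (_< 0ℚ) (sym (trans (cong (λ q → q + ε * (q - 1ℚ)) xi≡0) (eq ε))) (ℚ.neg-antimono-< 0<ε))
        (proj₁ (cube' i)))
      where
      eq : ∀ ε → 0ℚ + ε * (0ℚ - 1ℚ) ≡ - ε
      eq = solve-∀ ℚ-ring
    lt1 : ∀ i → x i < 1ℚ
    lt1 i = ≮∧≢⇒> (λ 1<x → ℚ.<-irrefl refl (ℚ.<-≤-trans 1<x (proj₂ (cube i)))) λ 1≡xi →
      let ε , 0<ε , (cube' , _) = origin in
      ℚ.<-irrefl refl (ℚ.<-≤-trans
        (subst₂ _<_ (ℚ.+-identityʳ 1ℚ) (trans (eq ε) (cong (λ q → q + ε * (q - 0ℚ)) 1≡xi)) (ℚ.+-monoʳ-< 1ℚ 0<ε))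
        (proj₂ (cube' i)))
      where
      eq : ∀ ε → 1ℚ + ε ≡ 1ℚ + ε * (1ℚ - 0ℚ)
      eq = solve-∀ ℚ-ring

  open⇒inP° : ∀ {x} → OpenCube x → InS fs x → InP° fs x
  open⇒inP° {x} cube x∈ = ((λ i → ℚ.<⇒≤ (proj₁ (cube i)) , ℚ.<⇒≤ (proj₂ (cube i))) , x∈) , λ y (_ , y∈) →
    let ε , 0<ε , inside = small-witness (small-∀ λ i → small-×
          (small-linear (x i - y i) (proj₁ (cube i)))
          (small-linear (- (x i - y i)) (0<q-p (proj₂ (cube i)))))
    in ε , 0<ε ,
       (λ i → ℚ.<⇒≤ (proj₁ (inside i)) ,
              ℚ.<⇒≤ (0<q-p⁻¹ (subst (0ℚ <_) (upper ε (x i) (y i)) (proj₂ (inside i))))) ,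
       λ i → trans (eval-cong (fs i) λ j → lin ε (x j) (y j)) (inS-comb {1ℚ + ε} {x} { - ε} {y} x∈ y∈ i)
    where
    upper : ∀ ε x y → 1ℚ - x + ε * - (x - y) ≡ 1ℚ - (x + ε * (x - y))
    upper = solve-∀ ℚ-ring
    lin : ∀ ε x y → x + ε * (x - y) ≡ (1ℚ + ε) * x + - ε * y
    lin = solve-∀ ℚ-ring

  -- Every flat meets P°: contract it towards the centre of the cube.
  contract : ∀ x → InS fs x → ∃ λ δ → 0ℚ < δ × InP° fs (comb 1ℚ (λ _ → ½) δ x)
  contract x x∈ =
    let δ , 0<δ , inside = small-witness (small-∀ λ i → small-×
          (small-linear (x i) 0<½) (small-linear (- x i) 0<½))
    in δ , 0<δ , open⇒inP°
      (λ i → subst (0ℚ <_) (lower ½ δ (x i)) (proj₁ (inside i)) ,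
             0<q-p⁻¹ (subst (0ℚ <_) (upper ½ δ (x i)) (proj₂ (inside i))))
      (inS-comb {1ℚ} {λ _ → ½} {δ} {x} (proj₁ (inFlat-const {[]} ½)) x∈)
    where
    0<½ : 0ℚ < ½
    0<½ = ℚ.positive⁻¹ ½
    lower : ∀ c δ p → c + δ * p ≡ 1ℚ * c + δ * p
    lower c δ p = cong (_+ δ * p) (sym (ℚ.*-identityˡ c))
    upper : ∀ c δ p → c + δ * - p ≡ c + c - (1ℚ * c + δ * p)
    upper = solve-∀ ℚ-ring

  -- Any point of the flat of `u` can be contracted into P°; since the centre has equal coordinates
  -- and δ ≠ 0, an equation x_j = x_k holds before the contraction if it holds after it.
  subU⇒⊨ : ∀ {u w} → SubU fs u w → All (u ⊨_) w
  subU⇒⊨ {u} {w} sub = All.tabulate λ {h} h∈ x (x∈ , hx) →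
    let δ , 0<δ , z∈ = contract x x∈
        z∈U = z∈ , All.map (λ {h'} p → onH-comb {1ℚ} {λ _ → ½} {δ} {x} h' refl p) hx
    in cancel h {δ} {x} 0<δ (All.lookup (proj₂ (sub _ z∈U)) h∈)
    where
    cancel : ∀ h {δ x} → 0ℚ < δ → OnH h (comb 1ℚ (λ _ → ½) δ x) → OnH h x
    cancel h 0<δ eq = *-cancelˡ (ℚ.<⇒≢ 0<δ ∘ sym) (∙-cancelˡ ℚ.+-0-abelianGroup (1ℚ * ½) _ _ eq)

  nonemptyU : ∀ S → NonemptyU fs S
  nonemptyU S = (λ _ → ½) ,
    open⇒inP° (λ _ → ℚ.positive⁻¹ ½ , 0<q-p⁻¹ (ℚ.positive⁻¹ ½)) (proj₁ (inFlat-const {S} ½)) ,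
    proj₂ (inFlat-const {S} ½)

  ⊨⇒subU : ∀ {u w} → All (u ⊨_) w → SubU fs u w
  ⊨⇒subU u⊨w x (x∈ , hx) = x∈ , All.map (λ u⊨h → u⊨h x (proj₂ (inP°⇒open x∈) , hx)) u⊨w

  -- `S ⊨ h` fails exactly if adjoining `h` makes the member of 𝓛 strictly smaller, which is what
  -- `below?` decides on `S` and `h ∷ S`.
  ⊨-dec : (∀ w u → Dec (Below fs w u)) → ∀ S h → Dec (S ⊨ h)
  ⊨-dec below? S h with below? S (h ∷ S)
  ... | yes (_ , ¬sub) = no λ S⊨h → ¬sub (⊨⇒subU (S⊨h ∷ All.tabulate λ h∈ x (_ , hx) → All.lookup hx h∈))
  ... | no ¬below = yes λ x x∈ → decidable-stable (onH? h x) λ x∉ →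
    ¬below ((λ y (y∈ , hy) → y∈ , All.tail hy) , λ sub → x∉ (All.head (subU⇒⊨ sub) x x∈))

  ∈⇒⊨ : ∀ {S h} → h ∈ S → S ⊨ h
  ∈⇒⊨ h∈ x (_ , hx) = All.lookup hx h∈

  ⊨-trans : ∀ {S T h} → All (T ⊨_) S → S ⊨ h → T ⊨ h
  ⊨-trans T⊨S S⊨h x x∈@(xs , _) = S⊨h x (xs , All.map (λ T⊨e → T⊨e x x∈) T⊨S)

  -- A point x of the flat of h' ∷ S off h would allow every y in the flat of S to be
  -- moved along x into h, hence into h', so that y itself would lie in h'.
  ⊨-exchange : ∀ {S h h'} → ¬ (S ⊨ h') → (h ∷ S) ⊨ h' → (h' ∷ S) ⊨ h
  ⊨-exchange {S} {h@(j , k)} {h'@(p , q)} S⊭h' hS⊨h' x (x∈s , x∈h' ∷ x∈S) =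
    decidable-stable (onH? h x) λ x∉h → S⊭h' λ y y∈ →
      -- These coefficients put a y + b x on `h`. In the resulting equation for `h'` the x terms
      -- cancel because x lies on `h'`, and then the factor a ≠ 0.
      let a = x j - x k
          b = - (y j - y k)
          z∈h' = hS⊨h' (comb a y b x) (let s , hs = inFlat-comb {S} {a} {y} {b} {x} y∈ (x∈s , x∈S)
                                       in s , meet (x j) (x k) (y j) (y k) ∷ hs)
      in *-cancelˡ (p-q≢0 x∉h) (∙-cancelʳ ℚ.+-0-abelianGroup (b * x p) _ _ (trans z∈h' (cong (λ r → a * y q + b * r) (sym x∈h'))))
    where
    meet : ∀ xj xk yj yk → (xj - xk) * yj + - (yj - yk) * xj ≡ (xj - xk) * yk + - (yj - yk) * xk
    meet = solve-∀ ℚ-ring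

  -- A region is represented by its vector of sides: convexity makes this faithful, and regions
  -- become data with decidable equality.
  Region : List (Pair d) → List (Pair d) → List Bool → Set
  Region V hs ε = ∃ λ x → InFlat fs V x × Generic hs x × sides hs x ≡ ε

  region-meet : ∀ {V h hs ε b} → Region V (h ∷ hs) (b ∷ ε) → Region V (h ∷ hs) (not b ∷ ε) → Region (h ∷ V) hs ε
  region-meet {V} {h@(j , k)} {hs} {ε} {b} (x , x∈ , gx@(x∉ ∷ gx') , sx) (y , y∈ , gy@(y∉ ∷ gy') , sy) =
    by (ℚ.<-cmp (x j) (x k)) (ℚ.<-cmp (y j) (y k))
    where
    same : All (λ h' → SameSide h' x y) hs
    same = sides⇒sameSide hs gx' gy' (trans (∷-injectiveʳ sx) (sym (∷-injectiveʳ sy)))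
    opposite : ¬ SameSide h x y
    opposite s = Bool.not-¬ (trans (sym (sameSide⇒side {x = x} {y} h s)) (∷-injectiveˡ sx)) (∷-injectiveˡ sy)
    mk : ∀ a c → 0ℚ < a → 0ℚ < c → OnH h (comb a x c y) → Region (h ∷ V) hs ε
    mk a c 0<a 0<c on =
      let g , eq = sameSide⇒sides {x = x} {comb a x c y} (All.map (λ {h'} → sameSide-comb {x = x} {y} 0<a 0<c h') same)
          s , hv = inFlat-comb {V} {a} {x} {c} {y} x∈ y∈
      in comb a x c y , (s , on ∷ hv) , g , trans (sym eq) (∷-injectiveʳ sx)
    meet : ∀ xj xk yj yk → (yj - yk) * xj + (xk - xj) * yj ≡ (yj - yk) * xk + (xk - xj) * yk
    meet = solve-∀ ℚ-ring
    meet' : ∀ xj xk yj yk → (yk - yj) * xj + (xj - xk) * yj ≡ (yk - yj) * xk + (xj - xk) * yk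
    meet' = solve-∀ ℚ-ring
    by : Tri (x j < x k) (x j ≡ x k) (x k < x j) → Tri (y j < y k) (y j ≡ y k) (y k < y j) → Region (h ∷ V) hs ε
    by (tri≈ _ e _) _            = contradiction e x∉
    by _            (tri≈ _ e _) = contradiction e y∉
    by (tri< p _ _) (tri< q _ _) = contradiction (inj₁ (p , q)) opposite
    by (tri> _ _ p) (tri> _ _ q) = contradiction (inj₂ (p , q)) opposite
    by (tri< p _ _) (tri> _ _ q) = mk (y j - y k) (x k - x j) (0<q-p q) (0<q-p p) (meet (x j) (x k) (y j) (y k))
    by (tri> _ _ p) (tri< q _ _) = mk (y k - y j) (x j - x k) (0<q-p q) (0<q-p p) (meet' (x j) (x k) (y j) (y k))

  module _ {V : List (Pair d)} {h : Pair d} (v : Pt d) (v∈ : InFlat fs V v) (v∉ : ¬ OnH h v) where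

    direction : ∀ b → ∃ λ w → InFlat fs V w × ¬ OnH h w × side w h ≡ b
    direction b with side v h Bool.≟ b
    ... | yes eq = v , v∈ , v∉ , eq
    -- The point -v, written as a `comb`: flats are linear, and negation exchanges the sides of `h`.
    ... | no neq = comb (- 1ℚ) v 0ℚ v , inFlat-comb {V} { - 1ℚ} {v} {0ℚ} {v} v∈ v∈ , w∉ ,
                   trans (flip h v∉) (sym (Bool.¬-not (neq ∘ sym)))
      where
      neg : ∀ p → - 1ℚ * p + 0ℚ * p ≡ - p
      neg = solve-∀ ℚ-ring
      w∉ : ¬ OnH h (comb (- 1ℚ) v 0ℚ v)
      w∉ eq = v∉ (ℚ.neg-injective (trans (sym (neg _)) (trans eq (neg _))))
      flip : ∀ h → ¬ OnH h v → side (comb (- 1ℚ) v 0ℚ v) h ≡ not (side v h)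
      flip (j , k) v∉ = by (comb (- 1ℚ) v 0ℚ v j ℚ.<? comb (- 1ℚ) v 0ℚ v k) (v j ℚ.<? v k)
        where
        by : (p : Dec (comb (- 1ℚ) v 0ℚ v j < comb (- 1ℚ) v 0ℚ v k)) (q : Dec (v j < v k)) → does p ≡ not (does q)
        by (yes p) (yes q) = contradiction (subst₂ _<_ (neg (v j)) (neg (v k)) p) (ℚ.<-asym (ℚ.neg-antimono-< q))
        by (yes _) (no _)  = refl
        by (no _)  (yes _) = refl
        by (no ¬p) (no ¬q) = contradiction
          (subst₂ _<_ (sym (neg (v j))) (sym (neg (v k))) (ℚ.neg-antimono-< (≮∧≢⇒> ¬q v∉))) ¬p

    -- From a point on `h`, a small move along a direction of the flat reaches either side of `h`
    -- and crosses no hyperplane of `hs`.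
    region-both : ∀ {hs ε} → Region (h ∷ V) hs ε → ∀ b → Region V (h ∷ hs) (b ∷ ε)
    region-both {hs} (x , (x∈s , x∈h ∷ x∈V) , gx , sx) b =
      let w , w∈ , w∉ , sw = direction b
          δ , 0<δ , same   = small-witness (small-All (All.map (λ {h'} → sameSide-small {x = x} {y = w} h') gx))
          gz , sz          = sameSide⇒sides {x = x} {comb 1ℚ x δ w} same
          hside            = sameSide-onH {x = x} {w} 0<δ h x∈h w∉
      in comb 1ℚ x δ w , inFlat-comb {V} {1ℚ} {x} {δ} {w} (x∈s , x∈V) w∈ ,
         sameSide⇒generic {x = w} {comb 1ℚ x δ w} h hside ∷ gz ,
         cong₂ _∷_ (trans (sym (sameSide⇒side {x = w} {comb 1ℚ x δ w} h hside)) sw) (trans (sym sz) sx)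

    region-extend : ∀ {hs ε} → Region V hs ε → ∃ λ b → Region V (h ∷ hs) (b ∷ ε)
    region-extend (x , x∈@(x∈s , x∈V) , gx , sx) with onH? h x
    ... | yes x∈h = true , region-both (x , (x∈s , x∈h ∷ x∈V) , gx , sx) true
    ... | no  x∉h = side x h , x , x∈ , x∉h ∷ gx , cong (side x h ∷_) sx

    region-tail : ∀ {hs b ε} → Region V (h ∷ hs) (b ∷ ε) → Region V hs ε
    region-tail (x , x∈ , _ ∷ gx , sx) = x , x∈ , gx , ∷-injectiveʳ sx

    -- Every region of the deletion contains a region on the side `bit`; it contains a second one,
    -- on the other side, exactly if `h` cuts it, that is, if its sign vector occurs in the
    -- restriction.
    HasCard-region-∷ : ∀ {hs m n} → HasCard (Region V hs) m → HasCard (Region (h ∷ V) hs) n →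
                       HasCard (Region V (h ∷ hs)) (m ℕ.+ n)
    HasCard-region-∷ {hs} (L , uL , refl , memL) (M , uM , refl , memM) =
      map near L ++ map far M ,
      ++⁺ (map⁺ ∷-injectiveʳ uL) (map⁺ ∷-injectiveʳ uM) disjoint ,
      trans (length-++ (map near L)) (cong₂ ℕ._+_ (length-map near L) (length-map far M)) ,
      λ ε → mk⇔ (sound ε) (complete ε)
      where
      open DecMembership (≡-dec Bool._≟_) using (_∈?_)
      -- Chosen through the decision `ε ∈? L` and not through a given membership proof, so that it
      -- depends on ε alone.
      bit : List Bool → Bool
      bit ε with ε ∈? L
      ... | yes ε∈ = proj₁ (region-extend (Equivalence.to (memL ε) ε∈))
      ... | no _   = true
      bit-region : ∀ ε → ε ∈ L → Region V (h ∷ hs) (bit ε ∷ ε)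
      bit-region ε ε∈L with ε ∈? L
      ... | yes ε∈ = proj₂ (region-extend (Equivalence.to (memL ε) ε∈))
      ... | no ε∉  = contradiction ε∈L ε∉
      near far : List Bool → List Bool
      near ε = bit ε ∷ ε
      far  ε = not (bit ε) ∷ ε
      disjoint : ∀ {ε} → ¬ (ε ∈ map near L × ε ∈ map far M)
      disjoint (p , q) with ε , _ , refl ← ∈-map⁻ near p with ε' , _ , eq ← ∈-map⁻ far q
        with refl ← ∷-injectiveʳ eq = Bool.not-¬ refl (∷-injectiveˡ eq)
      sound : ∀ ε → ε ∈ map near L ++ map far M → Region V (h ∷ hs) ε
      sound ε ε∈ with ∈-++⁻ (map near L) ε∈
      ... | inj₁ p with ε' , ε'∈ , refl ← ∈-map⁻ near p = bit-region ε' ε'∈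
      ... | inj₂ q with ε' , ε'∈ , refl ← ∈-map⁻ far q  = region-both (Equivalence.to (memM ε') ε'∈) _
      complete : ∀ ε → Region V (h ∷ hs) ε → ε ∈ map near L ++ map far M
      complete []      (_ , _ , _ , ())
      complete (b ∷ ε) r = by (b Bool.≟ bit ε)
        where
        ε∈L : ε ∈ L
        ε∈L = Equivalence.from (memL ε) (region-tail r)
        by : Dec (b ≡ bit ε) → b ∷ ε ∈ map near L ++ map far M
        by (yes refl) = ∈-++⁺ˡ (∈-map⁺ near ε∈L)
        by (no neq) with refl ← Bool.¬-not neq =
          ∈-++⁺ʳ (map near L) (∈-map⁺ far (Equivalence.from (memM ε) (region-meet (bit-region ε ε∈L) r)))

  module Regions (_⊨?_ : ∀ S h → Dec (S ⊨ h)) where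

    open Matroid _⊨_ _⊨?_ ∈⇒⊨ ⊨-trans ⊨-exchange public

    -- Zaslavsky's theorem.  Deletion–restriction needs a point of V off h, which V ⊭ h
    -- provides only up to double negation.
    HasCard-region : ∀ V hs → ¬ ¬ HasCard (Region V hs) (chambers V hs)
    HasCard-region V [] k = k ([] ∷ [] , [] ∷ [] , refl , λ ε → mk⇔
      (λ { (here refl) → (λ _ → 0ℚ) , inFlat-const 0ℚ , [] , refl })
      (λ { (_ , _ , _ , refl) → here refl }))
    HasCard-region V (h ∷ hs) k with V ⊨? h
    ... | yes V⊨h = k ([] , [] , refl , λ ε → mk⇔ (λ ())
      (λ { (x , x∈ , x∉ ∷ _ , _) → contradiction (V⊨h x x∈) x∉ }))
    ... | no V⊭h = HasCard-region V hs λ del → HasCard-region (h ∷ V) hs λ res →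
      V⊭h λ v v∈ → decidable-stable (onH? h v) λ v∉ → k (HasCard-region-∷ v v∈ v∉ del res)

-- Fractions with a common denominator

module _ (n : ℕ) .{{_ : NonZero n}} where

  /-mono-< : ∀ {i j} → i ℤ.< j → i ℚ./ n ℚ.< j ℚ./ n
  /-mono-< {i} {j} i<j = go n
    where
    go : ∀ n .{{_ : NonZero n}} → i ℚ./ n ℚ.< j ℚ./ n
    go (suc n) = ℚ.toℚᵘ-cancel-< (ℚᵘ.<-respˡ-≃ (ℚᵘ.≃-sym (ℚ.toℚᵘ-fromℚᵘ (ℚᵘ.mkℚᵘ i n)))
      (ℚᵘ.<-respʳ-≃ (ℚᵘ.≃-sym (ℚ.toℚᵘ-fromℚᵘ (ℚᵘ.mkℚᵘ j n))) (ℚᵘ.*<* (ℤ.*-monoʳ-<-pos (+ suc n) i<j))))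

  /-injective : ∀ {i j} → i ℚ./ n ≡ j ℚ./ n → i ≡ j
  /-injective {i} {j} eq with ℤ.<-cmp i j
  ... | tri< i<j _ _ = contradiction eq (ℚ.<⇒≢ (/-mono-< i<j))
  ... | tri≈ _ i≡j _ = i≡j
  ... | tri> _ _ j<i = contradiction (sym eq) (ℚ.<⇒≢ (/-mono-< j<i))

  /-cancel-< : ∀ {i j} → i ℚ./ n ℚ.< j ℚ./ n → i ℤ.< j
  /-cancel-< {i} {j} lt with ℤ.<-cmp i j
  ... | tri< i<j _ _  = i<j
  ... | tri≈ _ refl _ = contradiction lt (ℚ.<-irrefl refl)
  ... | tri> _ _ j<i  = contradiction lt (ℚ.<-asym (/-mono-< j<i))

  /-mono-≤ : ∀ {i j} → i ℤ.≤ j → i ℚ./ n ℚ.≤ j ℚ./ n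
  /-mono-≤ i≤j = ℚ.≮⇒≥ λ lt → ℤ.<⇒≱ (/-cancel-< lt) i≤j

  /-cancel-≤ : ∀ {i j} → i ℚ./ n ℚ.≤ j ℚ./ n → i ℤ.≤ j
  /-cancel-≤ le = ℤ.≮⇒≥ λ lt → ℚ.<-irrefl refl (ℚ.<-≤-trans (/-mono-< lt) le)

  n/n≡1 : + n ℚ./ n ≡ 1ℚ
  n/n≡1 = go n
    where
    go : ∀ n .{{_ : NonZero n}} → + n ℚ./ n ≡ 1ℚ
    go (suc n) = ℚ.fromℚᵘ-cong {ℚᵘ.mkℚᵘ (+ suc n) n} {ℚᵘ.mkℚᵘ 1ℤ 0} (ℚᵘ.*≡* (ℤ.*-comm (+ suc n) 1ℤ))

  /-*-/1 : ∀ i → i ℚ./ n ≡ 1ℤ ℚ./ n ℚ.* (i ℚ./ 1)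
  /-*-/1 i = go n
    where
    go : ∀ n .{{_ : NonZero n}} → i ℚ./ n ≡ 1ℤ ℚ./ n ℚ.* (i ℚ./ 1)
    go (suc n) = ℚ.toℚᵘ-injective (ℚᵘ.≃-trans (ℚ.toℚᵘ-fromℚᵘ (ℚᵘ.mkℚᵘ i n)) (ℚᵘ.≃-sym (ℚᵘ.≃-trans
      (ℚ.toℚᵘ-homo-* (1ℤ ℚ./ suc n) (i ℚ./ 1))
      (ℚᵘ.≃-trans (ℚᵘ.*-cong (ℚ.toℚᵘ-fromℚᵘ (ℚᵘ.mkℚᵘ 1ℤ n)) (ℚ.toℚᵘ-fromℚᵘ (ℚᵘ.mkℚᵘ i 0)))
                  (ℚᵘ.*≡* (eq i (+ suc n)))))))
      where
      eq : ∀ i n → 1ℤ ℤ.* i ℤ.* n ≡ i ℤ.* (n ℤ.* 1ℤ)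
      eq = ℤ-Solver.solve-∀

module _ {d m} (fs : Fin m → LinForm d) (t : ℕ) .{{_ : NonZero t}} (x : IPt d) where

  inS-scale : InS fs (toPt x) → InS fs (scale t x)
  inS-scale x∈ i = trans (eval-cong (fs i) λ j → /-*-/1 t (lookup x j))
    (trans (eval-scale (fs i) (1ℤ ℚ./ t) (toPt x)) (trans (cong (1ℤ ℚ./ t ℚ.*_) (x∈ i)) (ℚ.*-zeroʳ (1ℤ ℚ./ t))))

  inS-unscale : InS fs (scale t x) → InS fs (toPt x)
  inS-unscale x∈ i = *-cancelˡ 1/t≢0 (trans (sym (eval-scale (fs i) (1ℤ ℚ./ t) (toPt x)))
    (trans (sym (eval-cong (fs i) λ j → /-*-/1 t (lookup x j))) (trans (x∈ i) (sym (ℚ.*-zeroʳ (1ℤ ℚ./ t))))))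
    where
    1/t≢0 : 1ℤ ℚ./ t ≢ 0ℚ
    1/t≢0 eq with () ← /-injective t {1ℤ} {0ℤ} (trans eq (sym (ℚ.0/n≡0 t)))

module _ {d} (t : ℕ) .{{_ : NonZero t}} (x : IPt d) where

  onH-scale : ∀ h → OnH h (toPt x) → OnH h (scale t x)
  onH-scale (j , k) eq = cong (ℚ._/ t) (/-injective 1 {lookup x j} {lookup x k} eq)

  onH-unscale : ∀ h → OnH h (scale t x) → OnH h (toPt x)
  onH-unscale (j , k) eq = cong (ℚ._/ 1) (/-injective t {lookup x j} {lookup x k} eq)

  InOpenBox InClosedBox : Set
  InOpenBox   = ∀ i → (0ℤ ℤ.< lookup x i) × (lookup x i ℤ.< + t)
  InClosedBox = ∀ i → (0ℤ ℤ.≤ lookup x i) × (lookup x i ℤ.≤ + t)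

  openCube-scale : InOpenBox → OpenCube (scale t x)
  openCube-scale box i = subst (ℚ._< scale t x i) (ℚ.0/n≡0 t) (/-mono-< t (proj₁ (box i))) ,
                         subst (scale t x i ℚ.<_) (n/n≡1 t) (/-mono-< t (proj₂ (box i)))

  openCube-unscale : OpenCube (scale t x) → InOpenBox
  openCube-unscale cube i = /-cancel-< t (subst (ℚ._< scale t x i) (sym (ℚ.0/n≡0 t)) (proj₁ (cube i))) ,
                            /-cancel-< t (subst (scale t x i ℚ.<_) (sym (n/n≡1 t)) (proj₂ (cube i)))

  closedCube-scale : InClosedBox → ClosedCube (scale t x)
  closedCube-scale box i = subst (ℚ._≤ scale t x i) (ℚ.0/n≡0 t) (/-mono-≤ t (proj₁ (box i))) ,
                           subst (scale t x i ℚ.≤_) (n/n≡1 t) (/-mono-≤ t (proj₂ (box i)))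

  closedCube-unscale : ClosedCube (scale t x) → InClosedBox
  closedCube-unscale cube i = /-cancel-≤ t (subst (ℚ._≤ scale t x i) (sym (ℚ.0/n≡0 t)) (proj₁ (cube i))) ,
                              /-cancel-≤ t (subst (scale t x i ℚ.≤_) (sym (n/n≡1 t)) (proj₂ (cube i)))

-- Permutations realized by a point

-- If `j` were missed, punching it out would give an injection into a smaller set.
injective⇒surjective : ∀ {n} (f : Fin n → Fin n) → (∀ i j → f i ≡ f j → i ≡ j) → ∀ j → ∃ λ i → f i ≡ j
injective⇒surjective {suc n} f inj j with Fin.any? (λ i → f i Fin.≟ j)
... | yes hit = hit
... | no miss = contradiction (λ {a} {b} → g-inj {a} {b}) (Fin.<⇒notInjective {f = g} (ℕ.n<1+n n))
  where
  j≢ : ∀ i → j ≢ f i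
  j≢ i eq = miss (i , sym eq)
  g : Fin (suc n) → Fin n
  g i = Fin.punchOut (j≢ i)
  g-inj : ∀ {a b} → g a ≡ g b → a ≡ b
  g-inj {a} {b} eq = inj a b (Fin.punchOut-injective (j≢ a) (j≢ b) eq)

mono⇒inflationary : ∀ {n} (f : Fin n → Fin n) → (∀ i j → i Fin.< j → f i Fin.< f j) → ∀ i → i Fin.≤ f i
mono⇒inflationary {n} f mono i = go (Fin.toℕ i) i refl
  where
  go : ∀ k i → Fin.toℕ i ≡ k → k ℕ.≤ Fin.toℕ (f i)
  go zero    i _  = ℕ.z≤n
  go (suc k) i eq = ℕ.≤-<-trans (go k i⁻ toℕ-i⁻) (mono i⁻ i (subst₂ ℕ._<_ (sym toℕ-i⁻) (sym eq) ℕ.≤-refl))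
    where
    k<n : k ℕ.< n
    k<n = ℕ.<-trans (ℕ.n<1+n k) (subst (ℕ._< n) eq (Fin.toℕ<n i))
    i⁻ = Fin.fromℕ< k<n
    toℕ-i⁻ = Fin.toℕ-fromℕ< k<n

module _ {d} (σ : Perm d) (perm : IsPerm σ) where

  position : Fin d → Fin d
  position j = proj₁ (injective⇒surjective (lookup σ) perm j)

  lookup-position : ∀ j → lookup σ (position j) ≡ j
  lookup-position j = proj₂ (injective⇒surjective (lookup σ) perm j)

  position-mono : ∀ {y} → Realizes y σ → ∀ {j k} → y j ℚ.< y k → position j Fin.< position k
  position-mono {y} real {j} {k} yj<yk with Fin.<-cmp (position j) (position k)
  ... | tri< lt _ _ = lt
  ... | tri≈ _ eq _ = contradiction yj<yk (ℚ.<-irrefl (cong y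
        (trans (sym (lookup-position j)) (trans (cong (lookup σ) eq) (lookup-position k)))))
  ... | tri> _ _ gt = contradiction yj<yk (ℚ.<-asym
        (subst₂ (λ a b → y a ℚ.< y b) (lookup-position k) (lookup-position j) (real _ _ gt)))

  realizes⇒≢ : ∀ {y} → Realizes y σ → ∀ {j k} → j ≢ k → y j ≢ y k
  realizes⇒≢ {y} real {j} {k} j≢k with Fin.<-cmp (position j) (position k)
  ... | tri< lt _ _ = ℚ.<⇒≢ (subst₂ (λ a b → y a ℚ.< y b) (lookup-position j) (lookup-position k) (real _ _ lt))
  ... | tri≈ _ eq _ = contradiction (trans (sym (lookup-position j)) (trans (cong (lookup σ) eq) (lookup-position k))) j≢k
  ... | tri> _ _ gt = ℚ.<⇒≢ (subst₂ (λ a b → y a ℚ.< y b) (lookup-position k) (lookup-position j) (real _ _ gt)) ∘ sym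

  realizes-<-transfer : ∀ {y y'} → Realizes y σ → Realizes y' σ → ∀ {j k} → y j ℚ.< y k → y' j ℚ.< y' k
  realizes-<-transfer {y' = y'} real real' {j} {k} lt =
    subst₂ (λ a b → y' a ℚ.< y' b) (lookup-position j) (lookup-position k) (real' _ _ (position-mono real lt))

  realizes-sameSide : ∀ {y y'} → Realizes y σ → Realizes y' σ → ∀ {j k} → j ≢ k → SameSide (j , k) y y'
  realizes-sameSide {y} {y'} real real' {j} {k} j≢k with ℚ.<-cmp (y j) (y k)
  ... | tri< lt _ _ = inj₁ (lt , realizes-<-transfer {y} {y'} real real' lt)
  ... | tri≈ _ eq _ = contradiction eq (realizes⇒≢ {y} real j≢k)
  ... | tri> _ _ gt = inj₂ (gt , realizes-<-transfer {y} {y'} real real' gt)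

  compatible-≤ : ∀ {x : IPt d} {y} → Realizes y σ → Compatible x σ → ∀ {j k} → y j ℚ.< y k → lookup x j ℤ.≤ lookup x k
  compatible-≤ {x} {y} real comp {j} {k} lt =
    subst₂ (λ a b → lookup x a ℤ.≤ lookup x b) (lookup-position j) (lookup-position k) (comp _ _ (position-mono {y} real lt))

-- τ⁻¹σ and σ⁻¹τ are strictly increasing self-maps of [d], hence inflationary; being inverse to each
-- other, they are the identity.
realizes-unique : ∀ {d} {y : Pt d} {σ τ : Perm d} → IsPerm σ → IsPerm τ → Realizes y σ → Realizes y τ → σ ≡ τ
realizes-unique {d} {y} {σ} {τ} permσ permτ realσ realτ =
  trans (sym (Vec.tabulate∘lookup σ)) (trans (Vec.tabulate-cong agree) (Vec.tabulate∘lookup τ))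
  where
  f g : Fin d → Fin d
  f i = position τ permτ (lookup σ i)
  g i = position σ permσ (lookup τ i)
  f-mono : ∀ i j → i Fin.< j → f i Fin.< f j
  f-mono i j i<j = position-mono τ permτ {y} realτ (realσ i j i<j)
  g-mono : ∀ i j → i Fin.< j → g i Fin.< g j
  g-mono i j i<j = position-mono σ permσ {y} realσ (realτ i j i<j)
  g∘f : ∀ i → g (f i) ≡ i
  g∘f i = permσ _ _ (trans (lookup-position σ permσ _) (lookup-position τ permτ _))
  fixed : ∀ i → f i ≡ i
  fixed i = Fin.≤-antisym (subst (f i Fin.≤_) (g∘f i) (mono⇒inflationary g g-mono (f i))) (mono⇒inflationary f f-mono i)
  agree : ∀ i → lookup σ i ≡ lookup τ i
  agree i = trans (sym (lookup-position τ permτ (lookup σ i))) (cong (lookup τ) (fixed i))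

-- Entry i goes to the position given by the number of smaller entries.
realizer : ∀ {d} (y : Pt d) → (∀ i j → i ≢ j → y i ≢ y j) → ∃ λ σ → IsPerm σ × Realizes y σ
realizer {d} y distinct = σ , σ-perm , σ-real
  where
  below : Fin d → List (Fin d)
  below i = filter (λ j → y j ℚ.<? y i) (allFin d)
  below-mono : ∀ {i j} → y i ℚ.< y j → length (below i) ℕ.< length (below j)
  below-mono {i} {j} lt = length-filter-< (λ k → y k ℚ.<? y i) (λ k → y k ℚ.<? y j) (λ k p → ℚ.<-trans p lt)
    (allFin d) (∈-allFin i) (ℚ.<-irrefl refl) lt
  below<d : ∀ i → length (below i) ℕ.< d
  below<d i = subst (length (below i) ℕ.<_) (length-tabulate id)
    (filter-notAll (λ j → y j ℚ.<? y i) (allFin d) (lose (∈-allFin i) (ℚ.<-irrefl refl)))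
  rank : Fin d → Fin d
  rank i = Fin.fromℕ< (below<d i)
  rank-mono : ∀ {i j} → y i ℚ.< y j → rank i Fin.< rank j
  rank-mono lt = subst₂ ℕ._<_ (sym (Fin.toℕ-fromℕ< _)) (sym (Fin.toℕ-fromℕ< _)) (below-mono lt)
  rank-inj : ∀ i j → rank i ≡ rank j → i ≡ j
  rank-inj i j eq = decidable-stable (i Fin.≟ j) λ i≢j → by (ℚ.<-cmp (y i) (y j)) i≢j
    where
    by : Tri (y i ℚ.< y j) (y i ≡ y j) (y j ℚ.< y i) → ¬ (i ≢ j)
    by (tri< lt _ _) _   = Fin.<⇒≢ (rank-mono lt) eq
    by (tri≈ _ e _)  i≢j = distinct i j i≢j e
    by (tri> _ _ gt) _   = Fin.<⇒≢ (rank-mono gt) (sym eq)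
  unrank : Fin d → Fin d
  unrank k = proj₁ (injective⇒surjective rank rank-inj k)
  rank-unrank : ∀ k → rank (unrank k) ≡ k
  rank-unrank k = proj₂ (injective⇒surjective rank rank-inj k)
  σ : Perm d
  σ = tabulate unrank
  lookup-σ : ∀ k → lookup σ k ≡ unrank k
  lookup-σ = Vec.lookup∘tabulate unrank
  σ-perm : IsPerm σ
  σ-perm i j eq = trans (sym (rank-unrank i))
    (trans (cong rank (trans (sym (lookup-σ i)) (trans eq (lookup-σ j)))) (rank-unrank j))
  σ-real : Realizes y σ
  σ-real i j i<j = subst₂ (λ a b → y a ℚ.< y b) (sym (lookup-σ i)) (sym (lookup-σ j))
    (≮∧≢⇒> (λ gt → ℕ.<-asym i<j (subst₂ Fin._<_ (rank-unrank j) (rank-unrank i) (rank-mono gt)))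
           (distinct (unrank j) (unrank i) λ eq → ℕ.<-irrefl refl
             (subst (Fin._< j) (trans (sym (rank-unrank i)) (trans (cong rank (sym eq)) (rank-unrank j))) i<j)))

-- Permutations compatible with x and regions of the localization at x

_≟ᵛ_ : ∀ {d} (x y : IPt d) → Dec (x ≡ y)
_≟ᵛ_ = Vec.≡-dec ℤ._≟_

Increasing : ∀ {d} → Pair d → Set
Increasing (j , k) = j Fin.< k

module _ {d} (x : IPt d) where

  coincidence? : ∀ h → Dec (Increasing h × OnH h (toPt x))
  coincidence? h@(j , k) = (j Fin.<? k) ×-dec onH? h (toPt x)

  -- All hyperplanes through x are listed, not just generators of its flat: for x in s, increasing
  -- pairs entailed by the list are then members of it, as `μ-whitney` requires.
  coincidences : List (Pair d)
  coincidences = filter coincidence? (cartesianProduct (allFin d) (allFin d))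

  ∈-coincidences⁺ : ∀ {h} → Increasing h → OnH h (toPt x) → h ∈ coincidences
  ∈-coincidences⁺ {j , k} inc on = ∈-filter⁺ coincidence? (∈-cartesianProduct⁺ (∈-allFin j) (∈-allFin k)) (inc , on)

  ∈-coincidences⁻ : ∀ {h} → h ∈ coincidences → Increasing h × OnH h (toPt x)
  ∈-coincidences⁻ h∈ = proj₂ (∈-filter⁻ coincidence? {xs = cartesianProduct (allFin d) (allFin d)} h∈)

module Fibre {d m} (fs : Fin m → LinForm d) (weightZero : ∀ i → WeightZero (fs i))
             (t : ℕ) (x : IPt d) (x∈ : InS fs (toPt x)) (box : ∀ i → (0ℤ ℤ.≤ lookup x i) × (lookup x i ℤ.≤ + t)) where

  open Arrangement fs weightZero

  U : List (Pair d)
  U = coincidences x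

  U-≢ : ∀ {j k} → (j , k) ∈ U → j ≢ k
  U-≢ h∈ = Fin.<⇒≢ (proj₁ (∈-coincidences⁻ x h∈))

  realizes⇒generic : ∀ {σ y} → IsPerm σ → Realizes y σ → Generic U y
  realizes⇒generic {σ} {y} perm real = All.tabulate λ h∈ → realizes⇒≢ σ perm {y} real (U-≢ h∈)

  -- The sides are read off from any point of s realizing σ; all such points order each pair of
  -- coordinates alike.
  Induces : IPt d × Perm d → List Bool → Set
  Induces (_ , σ) ε = ∃ λ y → InS fs y × IsPerm σ × Realizes y σ × sides U y ≡ ε

  induces-functional : ∀ p ε ε' → Induces p ε → Induces p ε' → ε ≡ ε'
  induces-functional (_ , σ) ε ε' (y , _ , perm , real , eq) (y' , _ , _ , real' , eq') =
    trans (sym eq) (trans (proj₂ (sameSide⇒sides {x = y} {y'} (All.tabulate λ h∈ →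
      realizes-sameSide σ perm {y} {y'} real real' (U-≢ h∈)))) eq')

  induces-total : ∀ p → BPair fs t p → ∃ λ ε → Region [] U ε × Induces p ε
  induces-total (_ , σ) (_ , _ , perm , _ , (y , y∈ , real)) =
    sides U y , (y , (y∈ , []) , realizes⇒generic {σ} {y} perm real , refl) , (y , y∈ , perm , real , refl)

  -- The pairs with x_j ≠ x_k are ordered by compatibility with x, the others by ε.
  induces-injective : ∀ σ σ' ε → Compatible x σ → Compatible x σ' →
                      Induces (x , σ) ε → Induces (x , σ') ε → σ ≡ σ'
  induces-injective σ σ' ε comp comp' (y , _ , perm , real , eq) (y' , _ , perm' , real' , eq') =
    -- It suffices that `y`, which realizes σ, realizes σ' too, so each strict inequality of `y'` is
    -- transferred to `y`.
    realizes-unique {y = y} perm perm' real λ i j i<j → transfer (real' i j i<j)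
    where
    on-U : All (λ h → SameSide h y y') U
    on-U = sides⇒sameSide U (realizes⇒generic {σ} {y} perm real) (realizes⇒generic {σ'} {y'} perm' real')
                            (trans eq (sym eq'))
    same : ∀ {j k} → j Fin.< k → lookup x j ≡ lookup x k → SameSide (j , k) y y'
    same j<k xj≡xk = All.lookup on-U (∈-coincidences⁺ x j<k (cong (ℚ._/ 1) xj≡xk))
    transfer : ∀ {j k} → y' j ℚ.< y' k → y j ℚ.< y k
    transfer {j} {k} y'j<y'k = ≮∧≢⇒> wrong (realizes⇒≢ σ perm {y} real k≢j)
      where
      k≢j : k ≢ j
      k≢j k≡j = ℚ.<⇒≢ y'j<y'k (cong y' (sym k≡j))
      wrong : ¬ (y k ℚ.< y j)
      wrong yk<yj = by (Fin.<-cmp j k)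
        where
        -- If `y` and `y'` order j and k oppositely, the two compatibilities squeeze x_j and x_k
        -- together; the pair then belongs to `U`, where the sides agree.
        xj≡xk : lookup x j ≡ lookup x k
        xj≡xk = ℤ.≤-antisym (compatible-≤ σ' perm' {x} {y'} real' comp' y'j<y'k) (compatible-≤ σ perm {x} {y} real comp yk<yj)
        by : Tri (j Fin.< k) (j ≡ k) (k Fin.< j) → ⊥
        by (tri≈ _ j≡k _) = k≢j (sym j≡k)
        by (tri< j<k _ _) with same j<k xj≡xk
        ... | inj₁ (p , _) = ℚ.<-asym p yk<yj
        ... | inj₂ (_ , q) = ℚ.<-asym q y'j<y'k
        by (tri> _ _ k<j) with same k<j (sym xj≡xk)
        ... | inj₁ (_ , q) = ℚ.<-asym q y'j<y'k
        ... | inj₂ (p , _) = ℚ.<-asym p yk<yj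

  -- Perturb x towards a point of the region.
  induces-onto : ∀ ε → Region [] U ε → ∃ λ σ → BPair fs t (x , σ) × Induces (x , σ) ε
  induces-onto ε (y , (y∈ , _) , gen , eq) =
    let δ , 0<δ , keep = small-witness (small-∀ λ j → small-∀ λ k → strict j k)
    in build δ 0<δ keep
    where
    strict : ∀ j k → Small (λ δ → toPt x j ℚ.< toPt x k → comb 1ℚ (toPt x) δ y j ℚ.< comb 1ℚ (toPt x) δ y k)
    strict j k = by (toPt x j ℚ.<? toPt x k)
      where
      by : Dec (toPt x j ℚ.< toPt x k) →
           Small (λ δ → toPt x j ℚ.< toPt x k → comb 1ℚ (toPt x) δ y j ℚ.< comb 1ℚ (toPt x) δ y k)
      by (yes lt) = small-map (λ _ _ p _ → p) (comb-<-small {x = toPt x} {y} lt)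
      by (no ¬lt) = 1ℚ , ℚ.positive⁻¹ 1ℚ , λ _ _ _ lt → contradiction lt ¬lt
    build : ∀ δ → 0ℚ ℚ.< δ →
            (∀ j k → toPt x j ℚ.< toPt x k → comb 1ℚ (toPt x) δ y j ℚ.< comb 1ℚ (toPt x) δ y k) →
            ∃ λ σ → BPair fs t (x , σ) × Induces (x , σ) ε
    build δ 0<δ keep =
      let σ , perm , real = realizer z distinct
      in σ , (x∈ , box , perm , compatible σ real , (z , z∈ , real)) ,
         (z , z∈ , perm , real , trans (sym (proj₂ (sameSide⇒sides {x = y} {z} on-U))) eq)
      where
      z : Pt d
      z = comb 1ℚ (toPt x) δ y
      z∈ : InS fs z
      z∈ = inS-comb {1ℚ} {toPt x} {δ} {y} x∈ y∈
      on-U : All (λ h → SameSide h y z) U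
      on-U = All.tabulate λ {h} h∈ →
        sameSide-onH {x = toPt x} {y} 0<δ h (proj₂ (∈-coincidences⁻ x h∈)) (All.lookup gen h∈)
      distinct : ∀ j k → j ≢ k → z j ≢ z k
      distinct j k j≢k = by (ℚ.<-cmp (toPt x j) (toPt x k)) (Fin.<-cmp j k)
        where
        generic : ∀ {j k} → j Fin.< k → toPt x j ≡ toPt x k → z j ≢ z k
        generic {j} {k} j<k e = sameSide⇒generic {x = y} {z} (j , k) (All.lookup on-U (∈-coincidences⁺ x j<k e))
        by : Tri (toPt x j ℚ.< toPt x k) (toPt x j ≡ toPt x k) (toPt x k ℚ.< toPt x j) →
             Tri (j Fin.< k) (j ≡ k) (k Fin.< j) → z j ≢ z k
        by (tri< lt _ _) _              = ℚ.<⇒≢ (keep j k lt)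
        by (tri> _ _ gt) _              = ℚ.<⇒≢ (keep k j gt) ∘ sym
        by (tri≈ _ e _) (tri< j<k _ _)  = generic j<k e
        by (tri≈ _ e _) (tri≈ _ j≡k _)  = contradiction j≡k j≢k
        by (tri≈ _ e _) (tri> _ _ k<j)  = generic k<j (sym e) ∘ sym
      compatible : ∀ σ → Realizes z σ → Compatible x σ
      compatible σ real i j i<j = ℤ.≮⇒≥ λ lt → ℚ.<-asym (real i j i<j) (keep _ _ (/-mono-< 1 lt))

  length-fibre : ∀ {n} (bs : List (IPt d × Perm d)) → Unique bs → (∀ p → p ∈ bs ⇔ BPair fs t p) →
                 HasCard (Region [] U) n → length (filter (λ p → proj₁ p ≟ᵛ x) bs) ≡ n
  length-fibre bs ubs mem (L , uL , refl , memL) = length-≡-by Induces (filter⁺ over-x? ubs) uL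
    (λ p p∈ → let ε , reg , ind = induces-total p (Equivalence.to (mem p) (proj₁ (∈-filter⁻ over-x? p∈)))
              in ε , Equivalence.from (memL ε) reg , ind)
    (λ ε ε∈ → let σ , pair , ind = induces-onto ε (Equivalence.to (memL ε) ε∈)
              in (x , σ) , ∈-filter⁺ over-x? (Equivalence.from (mem (x , σ)) pair) refl , ind)
    injective
    induces-functional
    where
    over-x? = λ (p : IPt d × Perm d) → proj₁ p ≟ᵛ x
    injective : ∀ p p' ε → p ∈ filter over-x? bs → p' ∈ filter over-x? bs → Induces p ε → Induces p' ε → p ≡ p'
    injective (_ , σ) (_ , σ') ε p∈ p'∈ ind ind' =
      let q , e   = ∈-filter⁻ over-x? {xs = bs} p∈
          q' , e' = ∈-filter⁻ over-x? {xs = bs} p'∈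
      in same e e' (Equivalence.to (mem _) q) (Equivalence.to (mem _) q')
      where
      same : ∀ {a a'} → a ≡ x → a' ≡ x → BPair fs t (a , σ) → BPair fs t (a' , σ') → (a , σ) ≡ (a' , σ')
      same refl refl (_ , _ , _ , comp , _) (_ , _ , _ , comp' , _) =
        cong (x ,_) (induces-injective σ σ' ε comp comp' ind ind')

-- The lattice 𝓛 as a lattice of flats, and the two formulas.

AllPairsDistinct-map : ∀ {A : Set} {R S : A → A → Set} → (∀ {a b} → S a b → R a b) →
                       ∀ {as} → AllPairsDistinct R as → AllPairsDistinct S as
AllPairsDistinct-map f []         = []
AllPairsDistinct-map f (ps ∷ pss) = All.map (_∘ f) ps ∷ AllPairsDistinct-map f pss

module _ {d m} (fs : Fin m → LinForm d)
    (weightZero : ∀ i → WeightZero (fs i))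
    (magic : MagicExists fs)
    (reps : List (List (Pair d))) (enum : EnumL fs reps)
    (below? : ∀ w u → Dec (Below fs w u))
    (μ : List (Pair d) → ℤ)
    (μ-bottom : ∀ u → u ∈ reps → SameU fs u [] → μ u ≡ ℤ.+ 1)
    (μ-rec : ∀ u → u ∈ reps → ¬ SameU fs u [] →
      μ u ℤ.+ sumℤ (map μ (filter (λ w → below? w u) reps)) ≡ ℤ.+ 0)
    (t : ℕ) .{{_ : NonZero t}}
    where

  open Arrangement fs weightZero
  open Regions (⊨-dec below?)

  -- The magic labelling lies in s and on no h_jk.
  noLoop : ∀ {h} → Increasing h → ¬ ([] ⊨ h)
  noLoop {j , k} j<k all = let w , w∈ , distinct , _ = magic in
    distinct j k (Fin.<⇒≢ j<k) (/-injective 1 {lookup w j} {lookup w k} (all (toPt w) (w∈ , [])))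

  rep-increasing : ∀ {u} → u ∈ reps → All Increasing u
  rep-increasing u∈ = All.map proj₁ (proj₁ (All.lookup (proj₁ enum) u∈))

  -- Both conditions of the enumeration are met: an increasing pair is not a loop, hence indexes a
  -- member of 𝓗, and every flat contains the centre of the cube.
  cover : ∀ S → All Increasing S → ∃ λ S' → S' ∈ reps × S ≈ S'
  cover S inc =
    let S' , S'∈ , same = proj₂ (proj₂ enum) S
          (All.map (λ i → i , λ all → noLoop i λ x (x∈ , _) → all x x∈) inc) (nonemptyU S)
    in S' , S'∈ , subU⇒⊨ (λ x → proj₂ (same x)) , subU⇒⊨ (λ x → proj₁ (same x))

  open Flats Increasing reps cover
    (AllPairsDistinct-map (λ (a⊑b , b⊑a) x → ⊨⇒subU b⊑a x , ⊨⇒subU a⊑b x) (proj₁ (proj₂ enum)))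

  ⊑[]⇒sameU : ∀ {u} → u ⊑ [] → SameU fs u []
  ⊑[]⇒sameU u⊑[] x = (λ (x∈ , _) → x∈ , []) , ⊨⇒subU u⊑[] x

  open Möbius μ (λ u u∈ u⊑[] → μ-bottom u u∈ (⊑[]⇒sameU u⊑[]))
    (λ u u∈ u⋢[] → trans
      (cong (ℤ._+_ (μ u)) (trans
        (∑-cong reps λ w _ → cong (μ w ℤ.*_) (⟦⟧-cong (w ⊏? u) (below? w u)
          (λ (w⊑u , u⋢w) → ⊨⇒subU w⊑u , u⋢w ∘ subU⇒⊨)
          (λ (sub , ¬sub) → subU⇒⊨ sub , ¬sub ∘ ⊨⇒subU)))
        (sym (∑-filter (λ w → below? w u) μ reps))))
      (μ-rec u u∈ λ same → u⋢[] (subU⇒⊨ λ x → proj₂ (same x))))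

  On : List (Pair d) → IPt d → Set
  On u x = All (λ h → OnH h (toPt x)) u

  on? : ∀ u x → Dec (On u x)
  on? u x = all? (λ h → onH? h (toPt x)) u

  ⊑coincidences⇒on : ∀ {u} x → InS fs (toPt x) → u ⊑ coincidences x → On u x
  ⊑coincidences⇒on x x∈ = All.map λ U⊨h →
    U⊨h (toPt x) (x∈ , All.tabulate λ h∈ → proj₂ (∈-coincidences⁻ x h∈))

  on⇒∈coincidences : ∀ {u} x → All Increasing u → On u x → ∀ {h} → h ∈ u → h ∈ coincidences x
  on⇒∈coincidences x inc on h∈ = ∈-coincidences⁺ x (All.lookup inc h∈) (All.lookup on h∈)

  coincidences-increasing : ∀ (x : IPt d) → All Increasing (coincidences x)
  coincidences-increasing x = All.tabulate λ h∈ → proj₁ (∈-coincidences⁻ x h∈)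

  -- A point of s lies on the flat of `u` exactly if `u` is below the flat of x, so the flats
  -- through x form a lower interval.
  ∑-on : (g : List (Pair d) → ℤ) → ∀ x → InS fs (toPt x) →
         ∑ (λ u → g u ℤ.* ⟦ on? u x ⟧) reps ≡ ∑ (λ u → g u ℤ.* ⟦ u ⊑? coincidences x ⟧) reps
  ∑-on g x x∈ = ∑-cong reps λ u u∈ → cong (g u ℤ.*_) (⟦⟧-cong (on? u x) (u ⊑? coincidences x)
    (λ on → All.tabulate (∈⇒⊨ ∘ on⇒∈coincidences x (rep-increasing u∈) on))
    (⊑coincidences⇒on x x∈))

  module Dilate
    (Q : Pt d → Set) (Box : IPt d → Set)
    (scale⁺ : ∀ x → Box x → Q (scale t x)) (scale⁻ : ∀ x → Q (scale t x) → Box x)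
    (E : List (Pair d) → ℕ) (card : ∀ u → u ∈ reps → HasCard (InDilate Q (InFlat fs u) t) (E u))
    where

    dilate⁻ : ∀ {u} x → InDilate Q (InFlat fs u) t x → (Box x × InS fs (toPt x)) × On u x
    dilate⁻ x (q , s , hs) = (scale⁻ x q , inS-unscale fs t x s) , All.map (λ {h} → onH-unscale t x h) hs

    dilate⁺ : ∀ {u} x → Box x × InS fs (toPt x) → On u x → InDilate Q (InFlat fs u) t x
    dilate⁺ x (b , s) on = scale⁺ x b , inS-scale fs t x s , All.map (λ {h} → onH-scale t x h) on

    -- The finite list of integer points comes from the cardinality hypothesis at the bottom
    -- element, whose flat is s itself.
    points : ∃ λ xs → Unique xs × (∀ x → x ∈ xs ⇔ (Box x × InS fs (toPt x)))
    points =
      let u , u∈ , (_ , u⊑[]) = cover [] []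
          xs , ux , _ , mem   = card u u∈
      in xs , ux , λ x → mk⇔ (proj₁ ∘ dilate⁻ {u} x ∘ Equivalence.to (mem x))
        (λ q → Equivalence.from (mem x) (dilate⁺ {u} x q (All.map (λ []⊨h → []⊨h (toPt x) (proj₂ q , [])) u⊑[])))

    ∑-E : (g : List (Pair d) → ℤ) → ∑ (λ u → g u ℤ.* + E u) reps ≡
          ∑ (λ x → ∑ (λ u → g u ℤ.* ⟦ u ⊑? coincidences x ⟧) reps) (proj₁ points)
    ∑-E g = trans
      (∑-incidence on? g E reps xs λ u u∈ → HasCard-filter (on? u) xs ux mem (dilate⁻ {u}) (dilate⁺ {u}) (card u u∈))
      (∑-cong xs λ x x∈xs → ∑-on g x (proj₂ (Equivalence.to (mem x) x∈xs)))
      where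
      xs  = proj₁ points
      ux  = proj₁ (proj₂ points)
      mem = proj₂ (proj₂ points)

  open-formula : (Eo : List (Pair d) → ℕ) → (∀ u → u ∈ reps → HasCard (InDilate OpenCube (InFlat fs u) t) (Eo u)) →
                 ∀ bo → HasCard (BoPt fs t) bo → + bo ≡ ∑ (λ u → μ u ℤ.* + Eo u) reps
  open-formula Eo card bo cardBo = trans
    (HasCard-filter (λ x → coincidences x ⊑? []) xs ux mem
      (λ x (s , distinct , box) → (box , s) , distinct⇒⊑[] x distinct)
      (λ x (box , s) U⊑[] → s , ⊑[]⇒distinct x U⊑[] , box) cardBo)
    (trans (∑-cong xs λ x _ → sym (∑-μ (coincidences x) (coincidences-increasing x))) (sym (∑-E μ)))
    where
    open Dilate OpenCube (InOpenBox t) (openCube-scale t) (openCube-unscale t) Eo card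
    xs  = proj₁ points
    ux  = proj₁ (proj₂ points)
    mem = proj₂ (proj₂ points)
    distinct⇒⊑[] : ∀ x → DistinctEntries x → coincidences x ⊑ []
    distinct⇒⊑[] x distinct = All.tabulate λ { {j , k} h∈ → let j<k , on = ∈-coincidences⁻ x h∈ in
      contradiction (/-injective 1 {lookup x j} {lookup x k} on) (distinct j k (Fin.<⇒≢ j<k)) }
    ⊑[]⇒distinct : ∀ x → coincidences x ⊑ [] → DistinctEntries x
    ⊑[]⇒distinct x U⊑[] j k j≢k eq with Fin.<-cmp j k
    ... | tri< j<k _ _ = noLoop j<k (All.lookup U⊑[] (∈-coincidences⁺ x j<k (cong (ℚ._/ 1) eq)))
    ... | tri≈ _ j≡k _ = j≢k j≡k
    ... | tri> _ _ k<j = noLoop k<j (All.lookup U⊑[] (∈-coincidences⁺ x k<j (cong (ℚ._/ 1) (sym eq))))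

  closed-formula : (Ec : List (Pair d) → ℕ) → (∀ u → u ∈ reps → HasCard (InDilate ClosedCube (InFlat fs u) t) (Ec u)) →
                   ∀ b → HasCard (BPair fs t) b → b ≡ sum (map (λ u → ∣ μ u ∣ ℕ.* Ec u) reps)
  closed-formula Ec card b (bs , ubs , refl , memB) =
    ℤ.+-injective (trans by-fibres (trans (∑-cong xs fibre≡) (trans (sym (∑-E (λ u → + ∣ μ u ∣))) to-sum)))
    where
    open Dilate ClosedCube (InClosedBox t) (closedCube-scale t) (closedCube-unscale t) Ec card
    xs  = proj₁ points
    ux  = proj₁ (proj₂ points)
    mem = proj₂ (proj₂ points)
    by-fibres : + length bs ≡ ∑ (λ x → + length (filter (λ p → proj₁ p ≟ᵛ x) bs)) xs
    by-fibres = length-fibres _≟ᵛ_ proj₁ ux bs (All.tabulate λ {p} p∈ →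
      let s , box , _ = Equivalence.to (memB p) p∈ in Equivalence.from (mem (proj₁ p)) (box , s))
    to-sum : ∑ (λ u → + ∣ μ u ∣ ℤ.* + Ec u) reps ≡ + sum (map (λ u → ∣ μ u ∣ ℕ.* Ec u) reps)
    to-sum = trans (∑-cong reps λ u _ → sym (ℤ.pos-* ∣ μ u ∣ (Ec u))) (sym (+-sum (λ u → ∣ μ u ∣ ℕ.* Ec u) reps))
    fibre : ∀ x → InClosedBox t x × InS fs (toPt x) →
            length (filter (λ p → proj₁ p ≟ᵛ x) bs) ≡ chambers [] (coincidences x)
    -- Equality of natural numbers is decidable, so the double negation in `HasCard-region` can be
    -- discharged here.
    fibre x (box , s) = decidable-stable
      (length (filter (λ p → proj₁ p ≟ᵛ x) bs) ℕ.≟ chambers [] (coincidences x)) λ ≢ →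
      HasCard-region [] (coincidences x) λ regions → ≢ (Fibre.length-fibre fs weightZero t x s box bs ubs memB regions)
    local : ∀ x → InClosedBox t x × InS fs (toPt x) →
            ∑ (λ u → + ∣ μ u ∣ ℤ.* ⟦ u ⊑? coincidences x ⟧) reps ≡ + chambers [] (coincidences x)
    local x (_ , s) = ∑-∣μ∣ (coincidences x) (coincidences-increasing x)
      (λ u u∈ u⊑U → on⇒∈coincidences x (rep-increasing u∈) (⊑coincidences⇒on x s u⊑U))
      (λ h∈ → noLoop (proj₁ (∈-coincidences⁻ x h∈)))
    fibre≡ : ∀ x → x ∈ xs → + length (filter (λ p → proj₁ p ≟ᵛ x) bs) ≡
             ∑ (λ u → + ∣ μ u ∣ ℤ.* ⟦ u ⊑? coincidences x ⟧) reps
    fibre≡ x x∈ = let q = Equivalence.to (mem x) x∈ in trans (cong +_ (fibre x q)) (sym (local x q))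

theorem3p5 : ∀ {d m} (fs : Fin m → LinForm d) →
    (∀ i → WeightZero (fs i)) →
    MagicExists fs →
    (reps : List (List (Pair d))) → EnumL fs reps →
    (below? : ∀ w u → Dec (Below fs w u)) →
    (μ : List (Pair d) → ℤ) →
    (∀ u → u ∈ reps → SameU fs u [] → μ u ≡ ℤ.+ 1) →
    (∀ u → u ∈ reps → ¬ SameU fs u [] →
    μ u ℤ.+ sumℤ (map μ (filter (λ w → below? w u) reps)) ≡ ℤ.+ 0) →
    (t : ℕ) → .{{_ : NonZero t}} →
    (Eo Ec : List (Pair d) → ℕ) →
    (∀ u → u ∈ reps → HasCard (InDilate OpenCube (InFlat fs u) t) (Eo u)) →
    (∀ u → u ∈ reps → HasCard (InDilate ClosedCube (InFlat fs u) t) (Ec u)) →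
    (bo b : ℕ) → HasCard (BoPt fs t) bo → HasCard (BPair fs t) b →
    (ℤ.+ bo ≡ sumℤ (map (λ u → μ u ℤ.* ℤ.+ (Eo u)) reps))
    × (b ≡ sum (map (λ u → ∣ μ u ∣ ℕ.* Ec u) reps))
theorem3p5 fs weightZero magic reps enum below? μ μ-bottom μ-rec t Eo Ec cardEo cardEc bo b cardBo cardB =
  open-formula fs weightZero magic reps enum below? μ μ-bottom μ-rec t Eo cardEo bo cardBo ,
  closed-formula fs weightZero magic reps enum below? μ μ-bottom μ-rec t Ec cardEc b cardB
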